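{- Let $G$ be a connected graph with $n$ vertices, Laplacian matrix $L$, and $\tau(G)$ spanning trees. Then for any two distinct vertices $u,v$ of $G$, $$d_B(u,v)=\frac{\sqrt{\det\big(L^2(u,v\mid u,v)\big)}}{\sqrt n\,\tau(G)},$$ where $L^2(u,v\mid u,v)$ is the $(n-2)\times(n-2)$ matrix obtained from $L^2$ by deleting the rows and columns indexed by $u$ and $v$.
   Context: All graphs are finite, simple and undirected. The Laplacian matrix of $G$ is $L=D-A$ ($A$ adjacency matrix, $D$ diagonal degree matrix). $L^{+}$ is the Moore–Penrose inverse of $L$ and $L^{2+}=(L^{+})^2$. The biharmonic distance is the nonnegative number $d_B(u,v)$ with $d_B^2(u,v)=L^{2+}_{uu}+L^{2+}_{vv}-2L^{2+}_{uv}$. The determinant of a $0\times 0$ matrix is $1$. -}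

module Defs where

open import Data.Bool using (Bool; true; false; _∧_; _∨_; if_then_else_)
open import Data.Nat as ℕ using (ℕ; zero; suc; _∸_)
open import Data.Integer using (+_)
open import Data.Fin using (Fin; zero; suc; toℕ; punchIn; punchOut)
open import Data.Fin.Properties using () renaming (_≟_ to _≟ᶠ_)
open import Data.Nat.Properties using () renaming (_≟_ to _≟ⁿ_; _<?_ to _<?ⁿ_)
open import Data.List using (List; []; _∷_; _++_; map; length; filterᵇ; allFin; concatMap)
open import Data.Bool.ListAction using (any; all)
open import Data.Product using (_×_; _,_)
open import Data.Rational using (ℚ; 0ℚ; 1ℚ; _+_; _*_; -_; _-_; _/_)
open import Relation.Binary.PropositionalEquality using (_≡_; _≢_; refl)
open import Relation.Nullary.Decidable using (⌊_⌋)
open import Relation.Nullary using (contradiction)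

record Graph (n : ℕ) : Set where
  field
    adj    : Fin n → Fin n → Bool
    sym    : ∀ i j → adj i j ≡ adj j i
    irrefl : ∀ i → adj i i ≡ false
open Graph public

_==ᶠ_ : ∀ {n} → Fin n → Fin n → Bool
i ==ᶠ j = ⌊ i ≟ᶠ j ⌋

anyᶠ : ∀ {n} → (Fin n → Bool) → Bool
anyᶠ {n} p = any p (allFin n)

allᶠ : ∀ {n} → (Fin n → Bool) → Bool
allᶠ {n} p = all p (allFin n)

reach : ∀ {n} → (Fin n → Fin n → Bool) → ℕ → Fin n → Fin n → Bool
reach a zero    i j = i ==ᶠ j
reach a (suc k) i j = reach a k i j ∨ anyᶠ (λ l → reach a k i l ∧ a l j)

-- connected: any two vertices are joined by a walk (walks of length ≤ n suffice)
connectedᵇ : ∀ {n} → (Fin n → Fin n → Bool) → Bool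
connectedᵇ {n} a = allᶠ (λ i → allᶠ (λ j → reach a n i j))

Connected : ∀ {n} → Graph n → Set
Connected G = connectedᵇ (adj G) ≡ true

edges : ∀ {n} → Graph n → List (Fin n × Fin n)
edges {n} G =
  filterᵇ (λ { (i , j) → ⌊ toℕ i <?ⁿ toℕ j ⌋ ∧ adj G i j })
          (concatMap (λ i → map (λ j → (i , j)) (allFin n)) (allFin n))

-- all sub-lists (= all subsets of a duplicate-free list)
sublists : ∀ {A : Set} → List A → List (List A)
sublists []       = [] ∷ []
sublists (x ∷ xs) = map (x ∷_) (sublists xs) ++ sublists xs

edgeAdj : ∀ {n} → List (Fin n × Fin n) → Fin n → Fin n → Bool
edgeAdj F i j = any (λ { (a , b) → (a ==ᶠ i ∧ b ==ᶠ j) ∨ (a ==ᶠ j ∧ b ==ᶠ i) }) F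

-- a spanning subgraph (V(G), F) is a tree iff it is connected with n - 1 edges
isSpanningTree : ∀ {n} → List (Fin n × Fin n) → Bool
isSpanningTree {n} F = connectedᵇ (edgeAdj F) ∧ ⌊ length F ≟ⁿ (n ∸ 1) ⌋

τ : ∀ {n} → Graph n → ℕ
τ G = length (filterᵇ isSpanningTree (sublists (edges G)))

Mat : ℕ → Set
Mat n = Fin n → Fin n → ℚ

fromℕ : ℕ → ℚ
fromℕ k = (+ k) / 1

Σᶠ : ∀ {n} → (Fin n → ℚ) → ℚ
Σᶠ {zero}  f = 0ℚ
Σᶠ {suc n} f = f zero + Σᶠ (λ i → f (suc i))

_⊗_ : ∀ {n} → Mat n → Mat n → Mat n
(A ⊗ B) i j = Σᶠ (λ k → A i k * B k j)

transpose : ∀ {n} → Mat n → Mat n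
transpose A i j = A j i

degree : ∀ {n} → Graph n → Fin n → ℚ
degree G i = Σᶠ (λ j → if adj G i j then 1ℚ else 0ℚ)

laplacian : ∀ {n} → Graph n → Mat n
laplacian G i j =
  if i ==ᶠ j then degree G i else (if adj G i j then - 1ℚ else 0ℚ)

IsMoorePenroseInverse : ∀ {n} → Mat n → Mat n → Set
IsMoorePenroseInverse A X =
  (∀ i j → ((A ⊗ X) ⊗ A) i j ≡ A i j) ×
  (∀ i j → ((X ⊗ A) ⊗ X) i j ≡ X i j) ×
  (∀ i j → transpose (A ⊗ X) i j ≡ (A ⊗ X) i j) ×
  (∀ i j → transpose (X ⊗ A) i j ≡ (X ⊗ A) i j)

-- squared biharmonic distance, computed from L⁺ (so L^{2+} = L⁺ L⁺)
dB² : ∀ {n} → Mat n → Fin n → Fin n → ℚ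
dB² Lp u v = let L2p = Lp ⊗ Lp in (L2p u u + L2p v v) - (L2p u v + L2p u v)

sign : ℕ → ℚ
sign zero          = 1ℚ
sign (suc zero)    = - 1ℚ
sign (suc (suc k)) = sign k

det : ∀ {n} → Mat n → ℚ
det {zero}  A = 1ℚ
det {suc n} A =
  Σᶠ (λ j → sign (toℕ j) * (A zero j * det (λ i k → A (suc i) (punchIn j k))))

minor₂ : ∀ {n} (u v : Fin n) → u ≢ v → Mat n → Mat (n ∸ 2)
minor₂ {zero}        ()   v     _   A
minor₂ {suc zero}    zero zero  u≢v A = contradiction refl u≢v
minor₂ {suc (suc m)} u    v     u≢v A =
  λ i j → A (keep i) (keep j)
  where
  keep : Fin m → Fin (suc (suc m))
  keep i = punchIn u (punchIn (punchOut u≢v) i)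

{-# OPTIONS --safe #-}

-- Let M = L². On functions summing to zero M is inverted by (L⁺)², so with y the difference of the
-- columns v and u of (L⁺)², z = y - y(u) solves M z = e_v - e_u, vanishes at u and has z(v) = d_B²(u,v).
-- Cramer's rule for M with u deleted gives z(v) · det M(u|u) = det M(u,v|u,v).  Since the rows of L
-- sum to zero, M(u|u) = L(u|u) (I + J) L(u|u), whose determinant is n τ² by the matrix-tree theorem.
-- The latter is deletion-contraction on edge lists: L(u|u) is a Gram matrix of incidence vectors, and
-- adding an edge adds the Gram determinant of the contracted list.
module Submission where

open import Defs renaming (sym to adj-sym)
open import Algebra.Bundles using (CommutativeRing)
open import Data.Bool using (Bool; true; false; T; _∧_; _∨_; if_then_else_)
open import Data.Bool.Properties using (T-≡; T-∧; T-∨; ⇔→≡; ∧-zeroʳ)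
open import Data.Fin using (Fin; zero; suc; punchIn; punchOut; pinch; toℕ)
open import Data.Fin.Properties using (any?; punchIn-injective; punchIn-punchOut; punchInᵢ≢i; punchOut-cong; punchOut-punchIn; suc-injective; toℕ-injective) renaming (_≟_ to _≟ᶠ_)
open import Data.Fin.Subset using (Subset; ∣_∣; ⊥) renaming (_∈_ to _∈ˢ_)
open import Data.Fin.Subset.Properties using (p⊂q⇒∣p∣<∣q∣; ∣p∣≤n; ∉⊥; ⊥⊆)
import Data.Integer as ℤ
import Data.Integer.Properties as ℤ
open import Data.List using (List; []; _∷_; _++_; allFin; concatMap; filterᵇ; length; map) renaming (tabulate to tabulateˡ)
open import Data.List.Membership.Propositional using (_∈_; lose)
open import Data.List.Membership.Propositional.Properties using (∈-allFin; ∈-concatMap⁺; ∈-filter⁺; ∈-map⁺)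
open import Data.List.Properties using (length-map; map-++; map-∘)
open import Data.List.Relation.Unary.All as All using (All; []; _∷_)
import Data.List.Relation.Unary.All.Properties as All
import Data.List.Relation.Unary.Any as Any
import Data.List.Relation.Unary.Any.Properties as Any
open import Data.Nat as ℕ using (ℕ; zero; suc; z≤n; s≤s; _∸_)
open import Data.Nat.Coprimality using (1-coprimeTo) renaming (sym to coprime-sym)
import Data.Nat.Properties as ℕ
open import Data.Product using (∃; _×_; _,_; proj₁; proj₂)
open import Data.Rational using (ℚ; mkℚ; 0ℚ; 1ℚ; _+_; _*_; -_; _-_; _/_; _≤_; negative; positive)
open import Data.Rational.Properties
open import Data.Rational.Solver using (module +-*-Solver)
open import Data.Sum using (_⊎_; inj₁; inj₂; [_,_]′)
open import Data.Vec using (tabulate)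
open import Data.Vec.Functional using (updateAt) renaming (_∷_ to _∷ᵛ_)
open import Data.Vec.Functional.Properties using (updateAt-updates; updateAt-minimal)
open import Data.Vec.Properties using (lookup⇒[]=; []=⇒lookup; lookup∘tabulate)
open import Function using (Equivalence; _∘_; const; id; mk⇔)
open import Level using (0ℓ)
open import Relation.Binary.Bundles using (Setoid)
open import Relation.Binary.Definitions using (tri<; tri≈; tri>)
open import Relation.Binary.PropositionalEquality using (_≡_; _≢_; refl; sym; trans; cong; cong₂; cong-app; subst; module ≡-Reasoning)
import Relation.Binary.Reasoning.Setoid as SetoidReasoning
open import Relation.Nullary using (T?; contradiction; no; yes; ¬?)
open import Relation.Nullary.Decidable using (⌊_⌋; _×-dec_; fromWitness; toSum; toWitness)
import Algebra.Properties.Semiring.Sum (CommutativeRing.semiring +-*-commutativeRing) as Sum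
open +-*-Solver using (solve; _:=_; _:+_; _:*_; :-_; con)
open ≡-Reasoning

-- Finite sums and the Kronecker delta

-- `det` is given as expansion along the top row. Its theory is drawn from one principle: an
-- alternating multilinear form in n rows of length n is determined by its value at the identity.
-- Deletion-contraction suits the definition of `τ`, since `sublists (e ∷ E)` splits by whether `e`
-- is chosen; Cauchy-Binet would bring in sums over maximal minors instead. Contraction creates
-- loops and parallel edges and moves the deleted (grounded) vertex, so the induction runs over
-- arbitrary lists of vertex pairs and an arbitrary grounded vertex. Eigenvalues need not be
-- rational, so spectral arguments are replaced: the symmetry of the pseudoinverse and its commuting
-- with L come from the Penrose equations alone, and the kernel of L is found by writing the
-- quadratic form of L as a sum of squares. The identity is squared and its denominator cleared,
-- which keeps it inside ℚ; as n τ² is positive for a connected graph, the quotient form is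
-- equivalent.

Σ≡sum : ∀ {n} (f : Fin n → ℚ) → Σᶠ f ≡ Sum.sum f
Σ≡sum {zero}  f = refl
Σ≡sum {suc n} f = cong (f zero +_) (Σ≡sum (f ∘ suc))

Σ-cong : ∀ {n} {f g : Fin n → ℚ} → (∀ i → f i ≡ g i) → Σᶠ f ≡ Σᶠ g
Σ-cong {zero}  e = refl
Σ-cong {suc n} e = cong₂ _+_ (e zero) (Σ-cong (e ∘ suc))

Σ-+ : ∀ {n} (f g : Fin n → ℚ) → Σᶠ (λ i → f i + g i) ≡ Σᶠ f + Σᶠ g
Σ-+ f g = trans (Σ≡sum (λ i → f i + g i)) (trans (Sum.∑-distrib-+ f g) (sym (cong₂ _+_ (Σ≡sum f) (Σ≡sum g))))

Σ-*ˡ : ∀ {n} (a : ℚ) (f : Fin n → ℚ) → Σᶠ (λ i → a * f i) ≡ a * Σᶠ f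
Σ-*ˡ a f = trans (Σ≡sum (λ i → a * f i)) (sym (trans (cong (a *_) (Σ≡sum f)) (Sum.*-distribˡ-sum a f)))

Σ-*ʳ : ∀ {n} (a : ℚ) (f : Fin n → ℚ) → Σᶠ (λ i → f i * a) ≡ Σᶠ f * a
Σ-*ʳ a f = trans (Σ≡sum (λ i → f i * a)) (sym (trans (cong (_* a) (Σ≡sum f)) (Sum.*-distribʳ-sum a f)))

Σ-lin : ∀ {n} (a b : ℚ) (f g : Fin n → ℚ) →
        Σᶠ (λ i → a * f i + b * g i) ≡ a * Σᶠ f + b * Σᶠ g
Σ-lin a b f g = trans (Σ-+ (λ i → a * f i) (λ i → b * g i)) (cong₂ _+_ (Σ-*ˡ a f) (Σ-*ˡ b g))

Σ-neg : ∀ {n} (f : Fin n → ℚ) → Σᶠ (λ i → - f i) ≡ - Σᶠ f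
Σ-neg f = begin
  Σᶠ (λ i → - f i)          ≡⟨ Σ-cong (λ i → solve 1 (λ x → :- x := con (- 1ℚ) :* x) refl (f i)) ⟩
  Σᶠ (λ i → - 1ℚ * f i)     ≡⟨ Σ-*ˡ (- 1ℚ) f ⟩
  - 1ℚ * Σᶠ f               ≡⟨ solve 1 (λ x → con (- 1ℚ) :* x := :- x) refl (Σᶠ f) ⟩
  - Σᶠ f                    ∎

Σ-0 : ∀ {n} {f : Fin n → ℚ} → (∀ i → f i ≡ 0ℚ) → Σᶠ f ≡ 0ℚ
Σ-0 {zero}  e = refl
Σ-0 {suc n} e = trans (cong₂ _+_ (e zero) (Σ-0 (e ∘ suc))) (+-identityˡ 0ℚ)

Σ-swap : ∀ {m n} (f : Fin m → Fin n → ℚ) →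
         Σᶠ (λ i → Σᶠ (f i)) ≡ Σᶠ (λ j → Σᶠ (λ i → f i j))
Σ-swap f = begin
  Σᶠ (λ i → Σᶠ (f i))                     ≡⟨ Σ-cong (λ i → Σ≡sum (f i)) ⟩
  Σᶠ (λ i → Sum.sum (f i))                ≡⟨ Σ≡sum (λ i → Sum.sum (f i)) ⟩
  Sum.sum (λ i → Sum.sum (f i))           ≡⟨ Sum.∑-comm f ⟩
  Sum.sum (λ j → Sum.sum (λ i → f i j))   ≡⟨ Σ≡sum (λ j → Sum.sum (λ i → f i j)) ⟨
  Σᶠ (λ j → Sum.sum (λ i → f i j))        ≡⟨ Σ-cong (λ j → Σ≡sum (λ i → f i j)) ⟨
  Σᶠ (λ j → Σᶠ (λ i → f i j))             ∎

Σ-remove : ∀ {n} (u : Fin (suc n)) (f : Fin (suc n) → ℚ) → Σᶠ f ≡ f u + Σᶠ (f ∘ punchIn u)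
Σ-remove u f = trans (Σ≡sum f) (trans (Sum.sum-remove f) (cong (f u +_) (sym (Σ≡sum (f ∘ punchIn u)))))

-- Serves as the identity matrix, and `δ i` as the i-th unit vector.
δ : ∀ {n} → Fin n → Fin n → ℚ
δ i j = if i ==ᶠ j then 1ℚ else 0ℚ

δ-refl : ∀ {n} (i : Fin n) → δ i i ≡ 1ℚ
δ-refl i with i ≟ᶠ i
... | yes _   = refl
... | no  i≢i = contradiction refl i≢i

δ-≢ : ∀ {n} {i j : Fin n} → i ≢ j → δ i j ≡ 0ℚ
δ-≢ {i = i} {j} i≢j with i ≟ᶠ j
... | yes i≡j = contradiction i≡j i≢j
... | no  _   = refl

δ-sym : ∀ {n} (i j : Fin n) → δ i j ≡ δ j i
δ-sym i j with i ≟ᶠ j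
... | yes refl = sym (δ-refl i)
... | no  i≢j  = sym (δ-≢ (i≢j ∘ sym))

δ-inj : ∀ {m n} (f : Fin m → Fin n) → (∀ {i j} → f i ≡ f j → i ≡ j) → ∀ i j → δ (f i) (f j) ≡ δ i j
δ-inj f inj i j with i ≟ᶠ j
... | yes refl = δ-refl (f i)
... | no  i≢j  = δ-≢ (i≢j ∘ inj)

Σ-δˡ : ∀ {n} (i : Fin n) (f : Fin n → ℚ) → Σᶠ (λ k → δ i k * f k) ≡ f i
Σ-δˡ {suc n} i f = begin
  Σᶠ (λ k → δ i k * f k)
    ≡⟨ Σ-remove i (λ k → δ i k * f k) ⟩
  δ i i * f i + Σᶠ (λ k → δ i (punchIn i k) * f (punchIn i k))
    ≡⟨ cong₂ _+_ (trans (cong (_* f i) (δ-refl i)) (*-identityˡ (f i)))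
         (Σ-0 (λ k → trans (cong (_* f (punchIn i k)) (δ-≢ (punchInᵢ≢i i k ∘ sym))) (*-zeroˡ (f (punchIn i k))))) ⟩
  f i + 0ℚ
    ≡⟨ +-identityʳ (f i) ⟩
  f i ∎

Σ-δʳ : ∀ {n} (i : Fin n) (f : Fin n → ℚ) → Σᶠ (λ k → f k * δ k i) ≡ f i
Σ-δʳ i f = trans (Σ-cong (λ k → trans (*-comm (f k) (δ k i)) (cong (_* f k) (δ-sym k i)))) (Σ-δˡ i f)

-- Alternating multilinear forms

-- Rectangular, so that fixing the top row of a form leaves a form in one row fewer of the same
-- length; inductions on the number of rows rest on this.
Rows : ℕ → ℕ → Set
Rows m n = Fin m → Fin n → ℚ

infix 4 _≈_
_≈_ : ∀ {m n} → Rows m n → Rows m n → Set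
A ≈ B = ∀ i j → A i j ≡ B i j

AgreeOff : ∀ {m n} → Fin m → Rows m n → Rows m n → Set
AgreeOff i A B = ∀ k → k ≢ i → ∀ j → A k j ≡ B k j

infixl 9 _[_≔_]
_[_≔_] : ∀ {m n} → Rows m n → Fin m → (Fin n → ℚ) → Rows m n
A [ i ≔ r ] = updateAt A i (const r)

≔-same : ∀ {m n} (A : Rows m n) i r j → (A [ i ≔ r ]) i j ≡ r j
≔-same A i r j = cong-app (updateAt-updates i A) j

≔-off : ∀ {m n} (A : Rows m n) i r → AgreeOff i (A [ i ≔ r ]) A
≔-off A i r k k≢i j = cong-app (updateAt-minimal k i A k≢i) j

≔-≔-off : ∀ {m n} (A : Rows m n) i r s → AgreeOff i (A [ i ≔ r ]) (A [ i ≔ s ])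
≔-≔-off A i r s k k≢i j = trans (≔-off A i r k k≢i j) (sym (≔-off A i s k k≢i j))

≔-id : ∀ {m n} (A : Rows m n) i r → (∀ j → r j ≡ A i j) → A [ i ≔ r ] ≈ A
≔-id A i r e k j with k ≟ᶠ i
... | yes refl = trans (≔-same A i r j) (e j)
... | no  k≢i  = ≔-off A i r k k≢i j

-- Matrices are functions compared pointwise, so a form must respect `≈` explicitly. Linearity
-- relates three matrices that agree off row `i`, instead of three updates of one matrix, so that it
-- applies to minors and to rows put on top as well.
record Multilinear {m n} (F : Rows m n → ℚ) : Set where
  field
    resp   : ∀ {A B} → A ≈ B → F A ≡ F B
    linear : ∀ i a b {A B C} → AgreeOff i A B → AgreeOff i A C →
             (∀ j → A i j ≡ a * B i j + b * C i j) → F A ≡ a * F B + b * F C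

record Alternating {m n} (F : Rows m n → ℚ) : Set where
  field
    multilinear : Multilinear F
    vanish      : ∀ {A} i k → i ≢ k → (∀ j → A i j ≡ A k j) → F A ≡ 0ℚ
  open Multilinear multilinear public

∷-cong : ∀ {m n} {r s : Fin n → ℚ} {A B : Rows m n} →
         (∀ j → r j ≡ s j) → A ≈ B → (r ∷ᵛ A) ≈ (s ∷ᵛ B)
∷-cong e f zero    = e
∷-cong e f (suc i) = f i

∷-off : ∀ {m n} {r s : Fin n → ℚ} (A : Rows m n) → AgreeOff zero (r ∷ᵛ A) (s ∷ᵛ A)
∷-off A zero    0≢0 j = contradiction refl 0≢0
∷-off A (suc k) _   j = refl

∷-η : ∀ {m n} (A : Rows (suc m) n) → A ≈ (A zero ∷ᵛ (A ∘ suc))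
∷-η A zero    j = refl
∷-η A (suc i) j = refl

curry-multilinear : ∀ {m n} {F : Rows (suc m) n → ℚ} → Multilinear F →
                    ∀ r → Multilinear (λ B → F (r ∷ᵛ B))
curry-multilinear {F = F} M r = record
  { resp   = λ e → resp (∷-cong (λ _ → refl) e)
  ; linear = λ i a b p q e → linear (suc i) a b (off p) (off q) e
  }
  where
  open Multilinear M
  off : ∀ {i A B} → AgreeOff i A B → AgreeOff (suc i) (r ∷ᵛ A) (r ∷ᵛ B)
  off p zero    _  j = refl
  off p (suc k) ne j = p k (ne ∘ cong suc) j

curry-alternating : ∀ {m n} {F : Rows (suc m) n → ℚ} → Alternating F →
                    ∀ r → Alternating (λ B → F (r ∷ᵛ B))
curry-alternating Al r = record
  { multilinear = curry-multilinear multilinear r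
  ; vanish      = λ i k i≢k e → vanish (suc i) (suc k) (i≢k ∘ suc-injective) e
  }
  where open Alternating Al

-- A zero row is 0 times itself plus 0 times itself.
row-zero : ∀ {m n} {F : Rows m n → ℚ} → Multilinear F →
           ∀ {A} i → (∀ j → A i j ≡ 0ℚ) → F A ≡ 0ℚ
row-zero {F = F} M {A} i e = begin
  F A                          ≡⟨ linear i 0ℚ 0ℚ {A} {A} {A} (λ _ _ _ → refl) (λ _ _ _ → refl) (λ j → trans (e j) (sym (lem (A i j)))) ⟩
  0ℚ * F A + 0ℚ * F A          ≡⟨ lem (F A) ⟩
  0ℚ                           ∎
  where
  open Multilinear M
  lem : ∀ x → 0ℚ * x + 0ℚ * x ≡ 0ℚ
  lem = solve 1 (λ x → con 0ℚ :* x :+ con 0ℚ :* x := con 0ℚ) refl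

row-sum : ∀ {m n} {F : Rows m n → ℚ} → Multilinear F →
          ∀ A i {p} (c : Fin p → ℚ) (R : Rows p n) →
          F (A [ i ≔ (λ j → Σᶠ (λ k → c k * R k j)) ]) ≡ Σᶠ (λ k → c k * F (A [ i ≔ R k ]))
row-sum {F = F} M A i {zero} c R =
  row-zero M {A = A [ i ≔ (λ j → 0ℚ) ]} i (≔-same A i (λ j → 0ℚ))
row-sum {F = F} M A i {suc p} c R = begin
  F (A [ i ≔ (λ j → c zero * R zero j + s j) ])
    ≡⟨ linear i (c zero) 1ℚ (≔-≔-off A i _ _) (≔-≔-off A i _ _) (λ j → trans (≔-same A i _ j)
        (cong₂ _+_ (cong (c zero *_) (sym (≔-same A i _ j)))
                   (trans (sym (*-identityˡ (s j))) (cong (1ℚ *_) (sym (≔-same A i _ j)))))) ⟩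
  c zero * F (A [ i ≔ R zero ]) + 1ℚ * F (A [ i ≔ s ])
    ≡⟨ cong (c zero * F (A [ i ≔ R zero ]) +_)
         (trans (*-identityˡ _) (row-sum M A i (c ∘ suc) (R ∘ suc))) ⟩
  c zero * F (A [ i ≔ R zero ]) + Σᶠ (λ k → c (suc k) * F (A [ i ≔ R (suc k) ])) ∎
  where
  open Multilinear M
  s : Fin _ → ℚ
  s j = Σᶠ (λ k → c (suc k) * R (suc k) j)

head-sum : ∀ {m n} {F : Rows (suc m) n → ℚ} → Multilinear F →
           ∀ B {p} (c : Fin p → ℚ) (R : Rows p n) →
           F ((λ j → Σᶠ (λ k → c k * R k j)) ∷ᵛ B) ≡ Σᶠ (λ k → c k * F (R k ∷ᵛ B))
head-sum {F = F} M B c R = begin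
  F (s ∷ᵛ B)                                          ≡⟨ resp (upd s) ⟨
  F ((s ∷ᵛ B) [ zero ≔ s ])                           ≡⟨ row-sum M (s ∷ᵛ B) zero c R ⟩
  Σᶠ (λ k → c k * F ((s ∷ᵛ B) [ zero ≔ R k ]))        ≡⟨ Σ-cong (λ k → cong (c k *_) (resp (upd (R k)))) ⟩
  Σᶠ (λ k → c k * F (R k ∷ᵛ B))                       ∎
  where
  open Multilinear M
  s : Fin _ → ℚ
  s j = Σᶠ (λ k → c k * R k j)
  upd : ∀ r → ((s ∷ᵛ B) [ zero ≔ r ]) ≈ (r ∷ᵛ B)
  upd r zero    j = refl
  upd r (suc i) j = refl

head-add : ∀ {m n} {F : Rows (suc m) n → ℚ} → Multilinear F → ∀ a (x y : Fin n → ℚ) B →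
           F ((λ j → x j + a * y j) ∷ᵛ B) ≡ F (x ∷ᵛ B) + a * F (y ∷ᵛ B)
head-add {F = F} M a x y B = begin
  F ((λ j → x j + a * y j) ∷ᵛ B)
    ≡⟨ Multilinear.linear M zero 1ℚ a {B = x ∷ᵛ B} {C = y ∷ᵛ B} (∷-off B) (∷-off B) (λ j → cong (_+ a * y j) (sym (*-identityˡ (x j)))) ⟩
  1ℚ * F (x ∷ᵛ B) + a * F (y ∷ᵛ B)
    ≡⟨ cong (_+ a * F (y ∷ᵛ B)) (*-identityˡ (F (x ∷ᵛ B))) ⟩
  F (x ∷ᵛ B) + a * F (y ∷ᵛ B) ∎

_+ᵣ_⊠_ : ∀ {m n} → Rows m n → (Fin m → ℚ) → (Fin n → ℚ) → Rows m n
(B +ᵣ c ⊠ w) i j = B i j + c i * w j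

-- Multiples of `w` can be stripped from the rows one at a time. The typical `F` is an alternating
-- form whose top row is already fixed to `w`.
clear : ∀ {m n} {F : Rows m n → ℚ} → Multilinear F → ∀ B c w →
        (∀ {A} i → (∀ j → A i j ≡ w j) → F A ≡ 0ℚ) → F (B +ᵣ c ⊠ w) ≡ F B
clear {zero}  M B c w V = Multilinear.resp M (λ ())
clear {suc m} {F = F} M B c w V = begin
  F (B +ᵣ c ⊠ w)
    ≡⟨ resp (λ { zero j → refl ; (suc i) j → refl }) ⟩
  F ((λ j → B zero j + c zero * w j) ∷ᵛ R)
    ≡⟨ head-add M (c zero) (B zero) w R ⟩
  F (B zero ∷ᵛ R) + c zero * F (w ∷ᵛ R)
    ≡⟨ cong₂ _+_ (clear (curry-multilinear M (B zero)) (B ∘ suc) (c ∘ suc) w (λ i e → V (suc i) e))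
                 (trans (cong (c zero *_) (V zero (λ _ → refl))) (*-zeroʳ (c zero))) ⟩
  F (B zero ∷ᵛ (B ∘ suc)) + 0ℚ
    ≡⟨ +-identityʳ _ ⟩
  F (B zero ∷ᵛ (B ∘ suc))
    ≡⟨ resp (∷-η B) ⟨
  F B ∎
  where
  open Multilinear M
  R = (B ∘ suc) +ᵣ (c ∘ suc) ⊠ w

-- In the multilinear expansion every term that takes `w` in two rows vanishes, so only the terms of
-- degree at most one in `c` survive.
rank-one : ∀ {m n} {F : Rows m n → ℚ} → Alternating F → ∀ B c w →
           F (B +ᵣ c ⊠ w) ≡ F B + Σᶠ (λ i → c i * F (B [ i ≔ w ]))
rank-one {zero}  Al B c w = trans (Alternating.resp Al (λ ())) (sym (+-identityʳ _))
rank-one {suc m} {F = F} Al B c w = begin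
  F (B +ᵣ c ⊠ w)
    ≡⟨ resp (λ { zero j → refl ; (suc i) j → refl }) ⟩
  F ((λ j → B zero j + c zero * w j) ∷ᵛ R)
    ≡⟨ head-add multilinear (c zero) (B zero) w R ⟩
  F (B zero ∷ᵛ R) + c zero * F (w ∷ᵛ R)
    ≡⟨ cong₂ (λ x y → x + c zero * y)
         (trans (rank-one (curry-alternating Al (B zero)) (B ∘ suc) (c ∘ suc) w)
                (cong₂ _+_ (sym (resp (∷-η B))) (Σ-cong (λ i → cong (c (suc i) *_) (resp (upd i))))))
         (trans (clear (curry-multilinear multilinear w) (B ∘ suc) (c ∘ suc) w
                  (λ i e → vanish (suc i) zero (λ ()) e))
                (resp (λ { zero j → refl ; (suc i) j → refl }))) ⟩
  F B + S + c zero * F (B [ zero ≔ w ])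
    ≡⟨ solve 3 (λ x y z → x :+ y :+ z := x :+ (z :+ y)) refl (F B) S (c zero * F (B [ zero ≔ w ])) ⟩
  F B + (c zero * F (B [ zero ≔ w ]) + S) ∎
  where
  open Alternating Al
  R = (B ∘ suc) +ᵣ (c ∘ suc) ⊠ w
  S = Σᶠ (λ i → c (suc i) * F (B [ suc i ≔ w ]))
  upd : ∀ i → (B zero ∷ᵛ ((B ∘ suc) [ i ≔ w ])) ≈ (B [ suc i ≔ w ])
  upd i zero    j = refl
  upd i (suc k) j = refl

-- Polarisation: `F` vanishes with `x + y` in both top rows, and expanding leaves only the two mixed
-- terms. The padding by zeros and ones below matches that expansion literally.
swap-rows : ∀ {m n} {F : Rows (suc (suc m)) n → ℚ} → Alternating F → ∀ x y R →
            F (x ∷ᵛ (y ∷ᵛ R)) ≡ - F (y ∷ᵛ (x ∷ᵛ R))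
swap-rows {F = F} Al x y R = begin
  F (x ∷ᵛ (y ∷ᵛ R))
    ≡⟨ solve 2 (λ p q → p := con 0ℚ :+ con 1ℚ :* p :+ con 1ℚ :* (q :+ con 1ℚ :* con 0ℚ) :+ :- q) refl (F (x ∷ᵛ (y ∷ᵛ R))) (F (y ∷ᵛ (x ∷ᵛ R))) ⟩
  0ℚ + 1ℚ * F (x ∷ᵛ (y ∷ᵛ R)) + 1ℚ * (F (y ∷ᵛ (x ∷ᵛ R)) + 1ℚ * 0ℚ) + - F (y ∷ᵛ (x ∷ᵛ R))
    ≡⟨ cong (_+ - F (y ∷ᵛ (x ∷ᵛ R))) (sym total) ⟩
  0ℚ + - F (y ∷ᵛ (x ∷ᵛ R))
    ≡⟨ +-identityˡ _ ⟩
  - F (y ∷ᵛ (x ∷ᵛ R)) ∎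
  where
  open Alternating Al
  z : Fin _ → ℚ
  z j = x j + 1ℚ * y j
  twice : ∀ v → F (v ∷ᵛ (v ∷ᵛ R)) ≡ 0ℚ
  twice v = vanish zero (suc zero) (λ ()) (λ _ → refl)
  total : 0ℚ ≡ 0ℚ + 1ℚ * F (x ∷ᵛ (y ∷ᵛ R)) + 1ℚ * (F (y ∷ᵛ (x ∷ᵛ R)) + 1ℚ * 0ℚ)
  total = begin
    0ℚ                                               ≡⟨ twice z ⟨
    F (z ∷ᵛ (z ∷ᵛ R))                                ≡⟨ head-add multilinear 1ℚ x y (z ∷ᵛ R) ⟩
    F (x ∷ᵛ (z ∷ᵛ R)) + 1ℚ * F (y ∷ᵛ (z ∷ᵛ R))
      ≡⟨ cong₂ (λ p q → p + 1ℚ * q)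
           (trans (head-add (curry-multilinear multilinear x) 1ℚ x y R) (cong (_+ 1ℚ * F (x ∷ᵛ (y ∷ᵛ R))) (twice x)))
           (trans (head-add (curry-multilinear multilinear y) 1ℚ x y R) (cong (λ t → F (y ∷ᵛ (x ∷ᵛ R)) + 1ℚ * t) (twice y))) ⟩
    0ℚ + 1ℚ * F (x ∷ᵛ (y ∷ᵛ R)) + 1ℚ * (F (y ∷ᵛ (x ∷ᵛ R)) + 1ℚ * 0ℚ) ∎

sign-suc : ∀ k → sign (suc k) ≡ - sign k
sign-suc zero          = refl
sign-suc (suc zero)    = refl
sign-suc (suc (suc k)) = sign-suc k

sign² : ∀ k → sign k * sign k ≡ 1ℚ
sign² zero          = refl
sign² (suc zero)    = refl
sign² (suc (suc k)) = sign² k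

-- Row `k` climbs by `k` adjacent swaps. The last swap passes `B zero`; the earlier ones happen
-- below it, in the form with that row fixed.
move-to-front : ∀ {m n} {F : Rows (suc m) n → ℚ} → Alternating F → ∀ k B →
                F (B k ∷ᵛ (B ∘ punchIn k)) ≡ sign (toℕ k) * F B
move-to-front {F = F} Al zero B =
  trans (sym (Alternating.resp Al (∷-η B))) (sym (*-identityˡ (F B)))
move-to-front {suc m} {F = F} Al (suc k) B = begin
  F (B (suc k) ∷ᵛ (B ∘ punchIn (suc k)))
    ≡⟨ resp (λ { zero j → refl ; (suc zero) j → refl ; (suc (suc i)) j → refl }) ⟩
  F (B (suc k) ∷ᵛ (B zero ∷ᵛ (B ∘ suc ∘ punchIn k)))
    ≡⟨ swap-rows Al (B (suc k)) (B zero) (B ∘ suc ∘ punchIn k) ⟩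
  - F (B zero ∷ᵛ (B (suc k) ∷ᵛ (B ∘ suc ∘ punchIn k)))
    ≡⟨ cong -_ (move-to-front (curry-alternating Al (B zero)) k (B ∘ suc)) ⟩
  - (sign (toℕ k) * F (B zero ∷ᵛ (B ∘ suc)))
    ≡⟨ cong (λ x → - (sign (toℕ k) * x)) (sym (resp (∷-η B))) ⟩
  - (sign (toℕ k) * F B)
    ≡⟨ neg-distribˡ-* (sign (toℕ k)) (F B) ⟩
  - sign (toℕ k) * F B
    ≡⟨ cong (_* F B) (sign-suc (toℕ k)) ⟨
  sign (suc (toℕ k)) * F B ∎
  where open Alternating Al

-- Determinants

-- (j , k) ↦ (punchIn j k , pinch k j) exchanges the order in which two columns are deleted.
antisym-sum : ∀ {m} (G : Fin (suc m) → Fin m → ℚ) →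
              (∀ j k → G (punchIn j k) (pinch k j) ≡ - G j k) →
              Σᶠ (λ j → Σᶠ (G j)) ≡ 0ℚ
antisym-sum {zero}  G anti = refl
antisym-sum {suc m} G anti = begin
  Σᶠ (G zero) + Σᶠ (λ j → G (suc j) zero + Σᶠ (λ k → G (suc j) (suc k)))
    ≡⟨ cong (Σᶠ (G zero) +_) (Σ-+ (λ j → G (suc j) zero) (λ j → Σᶠ (λ k → G (suc j) (suc k)))) ⟩
  Σᶠ (G zero) + (Σᶠ (λ j → G (suc j) zero) + Σᶠ (λ j → Σᶠ (λ k → G (suc j) (suc k))))
    -- The involution exchanges (0 , k) with (k + 1 , 0), so the first row of `G` cancels its first
    -- column. On the remaining block it is the same involution shifted by one.
    ≡⟨ cong₂ (λ x y → Σᶠ (G zero) + (x + y))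
         (trans (Σ-cong (anti zero)) (Σ-neg (G zero)))
         (antisym-sum (λ j k → G (suc j) (suc k)) (λ j k → anti (suc j) (suc k))) ⟩
  Σᶠ (G zero) + (- Σᶠ (G zero) + 0ℚ)
    ≡⟨ solve 1 (λ x → x :+ (:- x :+ con 0ℚ) := con 0ℚ) refl (Σᶠ (G zero)) ⟩
  0ℚ ∎

-- If k < j, then `punchIn j k` is k and `pinch k j` is j - 1; otherwise they are k + 1 and j. The
-- sum of the exponents changes by one in either case.
sign-transpose : ∀ {m} (j : Fin (suc m)) (k : Fin m) →
                 sign (toℕ (punchIn j k)) * sign (toℕ (pinch k j)) ≡ - (sign (toℕ j) * sign (toℕ k))
sign-transpose {suc m} zero k = begin
  sign (suc (toℕ k)) * 1ℚ     ≡⟨ cong (_* 1ℚ) (sign-suc (toℕ k)) ⟩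
  - sign (toℕ k) * 1ℚ         ≡⟨ solve 1 (λ x → :- x :* con 1ℚ := :- (con 1ℚ :* x)) refl (sign (toℕ k)) ⟩
  - (1ℚ * sign (toℕ k))       ∎
sign-transpose (suc j) zero = begin
  1ℚ * sign (toℕ j)           ≡⟨ solve 1 (λ x → con 1ℚ :* x := :- (:- x :* con 1ℚ)) refl (sign (toℕ j)) ⟩
  - (- sign (toℕ j) * 1ℚ)     ≡⟨ cong (λ x → - (x * 1ℚ)) (sign-suc (toℕ j)) ⟨
  - (sign (suc (toℕ j)) * 1ℚ) ∎
sign-transpose (suc j) (suc k) = begin
  sign (suc (toℕ (punchIn j k))) * sign (suc (toℕ (pinch k j)))
    ≡⟨ neg-neg (toℕ (punchIn j k)) (toℕ (pinch k j)) ⟩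
  sign (toℕ (punchIn j k)) * sign (toℕ (pinch k j))
    ≡⟨ sign-transpose j k ⟩
  - (sign (toℕ j) * sign (toℕ k))
    ≡⟨ cong -_ (neg-neg (toℕ j) (toℕ k)) ⟨
  - (sign (suc (toℕ j)) * sign (suc (toℕ k))) ∎
  where
  neg-neg : ∀ a b → sign (suc a) * sign (suc b) ≡ sign a * sign b
  neg-neg a b = trans (cong₂ _*_ (sign-suc a) (sign-suc b))
                      (solve 2 (λ x y → :- x :* :- y := x :* y) refl (sign a) (sign b))

punchIn-pinch : ∀ {m} (j : Fin (suc m)) (k : Fin m) → punchIn (punchIn j k) (pinch k j) ≡ j
punchIn-pinch {suc m} zero    k       = refl
punchIn-pinch         (suc j) zero    = refl
punchIn-pinch         (suc j) (suc k) = cong suc (punchIn-pinch j k)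

-- Both sides enumerate, in increasing order, the indices other than `j` and `punchIn j k`. This
-- makes iterated minors independent of the order of deletion, and later lets grounding commute with
-- contraction.
punchIn-punchIn : ∀ {m} (j : Fin (suc (suc m))) (k : Fin (suc m)) (x : Fin m) →
                  punchIn (punchIn j k) (punchIn (pinch k j) x) ≡ punchIn j (punchIn k x)
punchIn-punchIn zero    k       x       = refl
punchIn-punchIn (suc j) zero    x       = refl
punchIn-punchIn (suc j) (suc k) zero    = refl
punchIn-punchIn (suc j) (suc k) (suc x) = cong suc (punchIn-punchIn j k x)

minor : ∀ {m} → Mat (suc m) → Fin (suc m) → Mat m
minor A j i k = A (suc i) (punchIn j k)

det-resp : ∀ {n} {A B : Mat n} → A ≈ B → det A ≡ det B
det-resp {zero}  e = refl
det-resp {suc n} e = Σ-cong λ j → cong₂ (λ x y → sign (toℕ j) * (x * y)) (e zero j)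
                       (det-resp (λ i k → e (suc i) (punchIn j k)))

det-linear : ∀ {n} i a b {A B C : Mat n} → AgreeOff i A B → AgreeOff i A C →
             (∀ j → A i j ≡ a * B i j + b * C i j) → det A ≡ a * det B + b * det C
det-linear {suc n} i a b {A} {B} {C} p q e =
  trans (Σ-cong (term i p q e))
        (Σ-lin a b (λ j → sign (toℕ j) * (B zero j * det (minor B j)))
                   (λ j → sign (toℕ j) * (C zero j * det (minor C j))))
  where
  term : ∀ i → AgreeOff i A B → AgreeOff i A C → (∀ j → A i j ≡ a * B i j + b * C i j) → ∀ j →
         sign (toℕ j) * (A zero j * det (minor A j)) ≡
         a * (sign (toℕ j) * (B zero j * det (minor B j))) + b * (sign (toℕ j) * (C zero j * det (minor C j)))
  term zero p q e j = begin
    sign (toℕ j) * (A zero j * det (minor A j))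
      ≡⟨ cong (λ x → sign (toℕ j) * (x * det (minor A j))) (e j) ⟩
    sign (toℕ j) * ((a * B zero j + b * C zero j) * det (minor A j))
      ≡⟨ solve 6 (λ s a x b y d → s :* ((a :* x :+ b :* y) :* d) := a :* (s :* (x :* d)) :+ b :* (s :* (y :* d)))
           refl (sign (toℕ j)) a (B zero j) b (C zero j) (det (minor A j)) ⟩
    a * (sign (toℕ j) * (B zero j * det (minor A j))) + b * (sign (toℕ j) * (C zero j * det (minor A j)))
      ≡⟨ cong₂ (λ x y → a * (sign (toℕ j) * (B zero j * x)) + b * (sign (toℕ j) * (C zero j * y)))
           (det-resp (λ i k → p (suc i) (λ ()) (punchIn j k)))
           (det-resp (λ i k → q (suc i) (λ ()) (punchIn j k))) ⟩
    a * (sign (toℕ j) * (B zero j * det (minor B j))) + b * (sign (toℕ j) * (C zero j * det (minor C j))) ∎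
  term (suc i) p q e j = begin
    sign (toℕ j) * (A zero j * det (minor A j))
      ≡⟨ cong (λ x → sign (toℕ j) * (A zero j * x))
           (det-linear i a b (λ k ne x → p (suc k) (ne ∘ suc-injective) (punchIn j x))
                             (λ k ne x → q (suc k) (ne ∘ suc-injective) (punchIn j x))
                             (λ x → e (punchIn j x))) ⟩
    sign (toℕ j) * (A zero j * (a * det (minor B j) + b * det (minor C j)))
      ≡⟨ solve 6 (λ s x a d b d' → s :* (x :* (a :* d :+ b :* d')) := a :* (s :* (x :* d)) :+ b :* (s :* (x :* d')))
           refl (sign (toℕ j)) (A zero j) a (det (minor B j)) b (det (minor C j)) ⟩
    a * (sign (toℕ j) * (A zero j * det (minor B j))) + b * (sign (toℕ j) * (A zero j * det (minor C j)))
      ≡⟨ cong₂ (λ x y → a * (sign (toℕ j) * (x * det (minor B j))) + b * (sign (toℕ j) * (y * det (minor C j))))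
           (p zero (λ ()) j) (q zero (λ ()) j) ⟩
    a * (sign (toℕ j) * (B zero j * det (minor B j))) + b * (sign (toℕ j) * (C zero j * det (minor C j))) ∎

det-multilinear : ∀ {n} → Multilinear (det {n})
det-multilinear = record { resp = det-resp ; linear = det-linear }

-- Expand along the two top rows. Exchanging the two chosen columns preserves the product of entries
-- and the minor, but flips the sign.
det-equal-top : ∀ {m} (A : Mat (suc (suc m))) → (∀ j → A zero j ≡ A (suc zero) j) → det A ≡ 0ℚ
det-equal-top A e = trans (Σ-cong expand) (antisym-sum G anti)
  where
  a = A (suc zero)
  s : ∀ {n} → Fin n → ℚ
  s j = sign (toℕ j)
  d : ∀ j k → ℚ
  d j k = det (minor (minor A j) k)
  G : ∀ j k → ℚ
  G j k = (s j * s k) * (a j * a (punchIn j k) * d j k)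
  expand : ∀ j → s j * (A zero j * det (minor A j)) ≡ Σᶠ (G j)
  expand j = begin
    s j * (A zero j * Σᶠ (λ k → s k * (a (punchIn j k) * d j k)))
      ≡⟨ *-assoc (s j) (A zero j) (Σᶠ (λ k → s k * (a (punchIn j k) * d j k))) ⟨
    (s j * A zero j) * Σᶠ (λ k → s k * (a (punchIn j k) * d j k))
      ≡⟨ Σ-*ˡ (s j * A zero j) (λ k → s k * (a (punchIn j k) * d j k)) ⟨
    Σᶠ (λ k → (s j * A zero j) * (s k * (a (punchIn j k) * d j k)))
      ≡⟨ Σ-cong (λ k → trans (cong (λ x → (s j * x) * (s k * (a (punchIn j k) * d j k))) (e j))
           (solve 5 (λ s x t y d → (s :* x) :* (t :* (y :* d)) := (s :* t) :* (x :* y :* d))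
              refl (s j) (a j) (s k) (a (punchIn j k)) (d j k))) ⟩
    Σᶠ (G j) ∎
  anti : ∀ j k → G (punchIn j k) (pinch k j) ≡ - G j k
  anti j k = begin
    (s (punchIn j k) * s (pinch k j)) * (a (punchIn j k) * a (punchIn (punchIn j k) (pinch k j)) * d (punchIn j k) (pinch k j))
      ≡⟨ cong₂ (λ x y → x * (a (punchIn j k) * y * d (punchIn j k) (pinch k j)))
           (sign-transpose j k) (cong a (punchIn-pinch j k)) ⟩
    - (s j * s k) * (a (punchIn j k) * a j * d (punchIn j k) (pinch k j))
      ≡⟨ cong (λ x → - (s j * s k) * (a (punchIn j k) * a j * x))
           (det-resp (λ i x → cong (A (suc (suc i))) (punchIn-punchIn j k x))) ⟩
    - (s j * s k) * (a (punchIn j k) * a j * d j k)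
      ≡⟨ solve 4 (λ s x y d → :- s :* (x :* y :* d) := :- (s :* (y :* x :* d))) refl (s j * s k) (a (punchIn j k)) (a j) (d j k) ⟩
    - G j k ∎

cancel-sign : ∀ k {x y} → sign k * x ≡ sign k * y → x ≡ y
cancel-sign k {x} {y} e = trans (sym (unit x)) (trans (cong (sign k *_) e) (unit y))
  where
  unit : ∀ z → sign k * (sign k * z) ≡ z
  unit z = trans (sym (*-assoc (sign k) (sign k) z)) (trans (cong (_* z) (sign² k)) (*-identityˡ z))

-- Mutual induction on the size: alternation of the smaller determinant allows a row of each minor
-- to be moved to its top, which reduces a row equal to the top row to the case of two equal top
-- rows.
det-vanish : ∀ n {A : Mat n} i k → i ≢ k → (∀ j → A i j ≡ A k j) → det A ≡ 0ℚ

det-alternating : ∀ {n} → Alternating (det {n})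
det-alternating {n} = record { multilinear = det-multilinear ; vanish = det-vanish n }

det-vanish-top : ∀ m {A : Mat (suc m)} k → (∀ j → A zero j ≡ A (suc k) j) → det A ≡ 0ℚ
det-vanish-top (suc m) {A} k e = cancel-sign (toℕ k) (begin
  sign (toℕ k) * det A
    ≡⟨ Σ-*ˡ (sign (toℕ k)) (λ j → sign (toℕ j) * (A zero j * det (minor A j))) ⟨
  Σᶠ (λ j → sign (toℕ k) * (sign (toℕ j) * (A zero j * det (minor A j))))
    ≡⟨ Σ-cong (λ j → trans (solve 4 (λ s t x d → s :* (t :* (x :* d)) := t :* (x :* (s :* d))) refl
                              (sign (toℕ k)) (sign (toℕ j)) (A zero j) (det (minor A j)))
                      (cong (λ x → sign (toℕ j) * (A zero j * x))
                        (trans (sym (move-to-front (det-alternating {suc m}) k (minor A j)))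
                               (det-resp {suc m} {minor A j k ∷ᵛ (minor A j ∘ punchIn k)} {minor B j} (λ { zero x → refl ; (suc i) x → refl }))))) ⟩
  det B
    ≡⟨ det-equal-top B e ⟩
  0ℚ
    ≡⟨ *-zeroʳ (sign (toℕ k)) ⟨
  sign (toℕ k) * 0ℚ ∎)
  where
  B : Mat (suc (suc m))
  B = A zero ∷ᵛ (A (suc k) ∷ᵛ (A ∘ suc ∘ punchIn k))

det-vanish (suc n) zero    zero    i≢k e = contradiction refl i≢k
det-vanish (suc n) {A} zero (suc k) i≢k e = det-vanish-top n {A} k e
det-vanish (suc n) {A} (suc i) zero i≢k e = det-vanish-top n {A} i (λ j → sym (e j))
det-vanish (suc n) {A} (suc i) (suc k) i≢k e = Σ-0 (λ j → begin
  sign (toℕ j) * (A zero j * det (minor A j))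
    ≡⟨ cong (λ x → sign (toℕ j) * (A zero j * x)) (det-vanish n i k (i≢k ∘ cong suc) (λ x → e (punchIn j x))) ⟩
  sign (toℕ j) * (A zero j * 0ℚ)
    ≡⟨ solve 2 (λ s x → s :* (x :* con 0ℚ) := con 0ℚ) refl (sign (toℕ j)) (A zero j) ⟩
  0ℚ ∎)

-- Inserts a zero at position `k`. The form as a combination of unit vectors makes linearity in `r`
-- a matter of finite sums.
extend : ∀ {n} → Fin (suc n) → (Fin n → ℚ) → Fin (suc n) → ℚ
extend k r j = Σᶠ (λ l → r l * δ (punchIn k l) j)

extend-δ : ∀ {n} (k : Fin (suc n)) i j → extend k (δ i) j ≡ δ (punchIn k i) j
extend-δ k i j = Σ-δˡ i (λ l → δ (punchIn k l) j)

extend-split : ∀ {n} (k : Fin (suc n)) (r : Fin (suc n) → ℚ) j →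
               r j ≡ extend k (r ∘ punchIn k) j + r k * δ k j
extend-split k r j = begin
  r j                                          ≡⟨ Σ-δʳ j r ⟨
  Σᶠ (λ l → r l * δ l j)                       ≡⟨ Σ-remove k (λ l → r l * δ l j) ⟩
  r k * δ k j + extend k (r ∘ punchIn k) j     ≡⟨ +-comm (r k * δ k j) (extend k (r ∘ punchIn k) j) ⟩
  extend k (r ∘ punchIn k) j + r k * δ k j     ∎

extend-alternating : ∀ {m n} {F : Rows m (suc n) → ℚ} → Alternating F → ∀ k →
                     Alternating (λ B → F (λ i → extend k (B i)))
extend-alternating Al k = record
  { multilinear = record
    { resp   = λ e → resp (λ i → ext (e i))
    ; linear = λ i a b {A} {B} {C} p q e → linear i a b (λ x ne → ext (p x ne)) (λ x ne → ext (q x ne))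
        (λ j → trans (Σ-cong (λ l → trans (cong (_* δ (punchIn k l) j) (e l))
                        (solve 5 (λ a x b y d → (a :* x :+ b :* y) :* d := a :* (x :* d) :+ b :* (y :* d)) refl
                          a (B i l) b (C i l) (δ (punchIn k l) j))))
                     (Σ-lin a b (λ l → B i l * δ (punchIn k l) j) (λ l → C i l * δ (punchIn k l) j)))
    }
  ; vanish = λ i x ne e → vanish i x ne (ext e)
  }
  where
  open Alternating Al
  ext : ∀ {r s} → (∀ l → r l ≡ s l) → ∀ j → extend k r j ≡ extend k s j
  ext e j = Σ-cong (λ l → cong (_* δ (punchIn k l) j) (e l))

-- Expand the top row in unit vectors. Below `δ k` on top, column `k` can be cleared from all rows,
-- which leaves an alternating form of the minor, and induction applies to it.
det-unique : ∀ {n} {F : Mat n → ℚ} → Alternating F → ∀ A → F A ≡ F δ * det A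
det-unique {zero}  {F} Al A = trans (Alternating.resp Al (λ ())) (sym (*-identityʳ (F δ)))
det-unique {suc n} {F} Al A = begin
  F A
    ≡⟨ resp (λ { zero j → sym (Σ-δʳ j (A zero)) ; (suc i) j → refl }) ⟩
  F ((λ j → Σᶠ (λ k → A zero k * δ k j)) ∷ᵛ (A ∘ suc))
    ≡⟨ head-sum multilinear (A ∘ suc) (A zero) δ ⟩
  Σᶠ (λ k → A zero k * F (δ k ∷ᵛ (A ∘ suc)))
    ≡⟨ Σ-cong (λ k → trans (cong (A zero k *_) (reduce k))
         (solve 4 (λ a s f d → a :* (s :* f :* d) := f :* (s :* (a :* d))) refl
            (A zero k) (sign (toℕ k)) (F δ) (det (minor A k)))) ⟩
  Σᶠ (λ k → F δ * (sign (toℕ k) * (A zero k * det (minor A k))))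
    ≡⟨ Σ-*ˡ (F δ) (λ k → sign (toℕ k) * (A zero k * det (minor A k))) ⟩
  F δ * det A ∎
  where
  open Alternating Al
  reduce : ∀ k → F (δ k ∷ᵛ (A ∘ suc)) ≡ sign (toℕ k) * F δ * det (minor A k)
  reduce k = begin
    F (δ k ∷ᵛ (A ∘ suc))
      ≡⟨ resp (∷-cong (λ _ → refl) (λ i → extend-split k (A (suc i)))) ⟩
    F (δ k ∷ᵛ ((λ i → extend k (minor A k i)) +ᵣ (λ i → A (suc i) k) ⊠ δ k))
      ≡⟨ clear (curry-multilinear multilinear (δ k)) (λ i → extend k (minor A k i)) (λ i → A (suc i) k) (δ k)
           (λ i e → vanish (suc i) zero (λ ()) e) ⟩
    F (δ k ∷ᵛ (λ i → extend k (minor A k i)))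
      ≡⟨ det-unique (extend-alternating (curry-alternating Al (δ k)) k) (minor A k) ⟩
    F (δ k ∷ᵛ (λ i → extend k (δ i))) * det (minor A k)
      ≡⟨ cong (_* det (minor A k)) (resp (∷-cong (λ _ → refl) (extend-δ k))) ⟩
    F (δ k ∷ᵛ (δ ∘ punchIn k)) * det (minor A k)
      ≡⟨ cong (_* det (minor A k)) (move-to-front Al k δ) ⟩
    sign (toℕ k) * F δ * det (minor A k) ∎

det-expand-unit : ∀ {n} k (A : Mat (suc n)) → (∀ j → A zero j ≡ δ k j) → det A ≡ sign (toℕ k) * det (minor A k)
det-expand-unit k A e = begin
  Σᶠ (λ j → sign (toℕ j) * (A zero j * det (minor A j)))
    ≡⟨ Σ-cong (λ j → trans (cong (λ x → sign (toℕ j) * (x * det (minor A j))) (e j))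
         (solve 3 (λ s x d → s :* (x :* d) := x :* (s :* d)) refl (sign (toℕ j)) (δ k j) (det (minor A j)))) ⟩
  Σᶠ (λ j → δ k j * (sign (toℕ j) * det (minor A j)))
    ≡⟨ Σ-δˡ k (λ j → sign (toℕ j) * det (minor A j)) ⟩
  sign (toℕ k) * det (minor A k) ∎

det-δ : ∀ n → det (δ {n}) ≡ 1ℚ
det-δ zero    = refl
det-δ (suc n) = begin
  det (δ {suc n})                       ≡⟨ det-expand-unit zero (δ {suc n}) (λ _ → refl) ⟩
  1ℚ * det (minor (δ {suc n}) zero)     ≡⟨ *-identityˡ (det (minor (δ {suc n}) zero)) ⟩
  det (minor (δ {suc n}) zero)          ≡⟨ det-resp {n} {minor (δ {suc n}) zero} {δ} (δ-inj suc suc-injective) ⟩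
  det (δ {n})                           ≡⟨ det-δ n ⟩
  1ℚ                                    ∎

-- For fixed `B` the left side is alternating in the rows of `A`, with value `det B` at the
-- identity.
det-⊗ : ∀ {n} (A B : Mat n) → det (A ⊗ B) ≡ det A * det B
det-⊗ A B = begin
  det (A ⊗ B)             ≡⟨ det-unique alternating A ⟩
  det (δ ⊗ B) * det A     ≡⟨ cong (_* det A) (det-resp (λ i j → Σ-δˡ i (λ k → B k j))) ⟩
  det B * det A           ≡⟨ *-comm (det B) (det A) ⟩
  det A * det B           ∎
  where
  row : ∀ {r s : Fin _ → ℚ} → (∀ k → r k ≡ s k) → ∀ j → Σᶠ (λ k → r k * B k j) ≡ Σᶠ (λ k → s k * B k j)
  row e j = Σ-cong (λ k → cong (_* B k j) (e k))
  alternating : Alternating (λ A → det (A ⊗ B))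
  alternating = record
    { multilinear = record
      { resp   = λ e → det-resp (λ i → row (e i))
      ; linear = λ i a b {A} {X} {Y} p q e → det-linear i a b (λ k ne → row (p k ne)) (λ k ne → row (q k ne))
          (λ j → trans (Σ-cong (λ k → trans (cong (_* B k j) (e k))
                          (solve 5 (λ a x b y d → (a :* x :+ b :* y) :* d := a :* (x :* d) :+ b :* (y :* d)) refl
                            a (X i k) b (Y i k) (B k j))))
                       (Σ-lin a b (λ k → X i k * B k j) (λ k → Y i k * B k j)))
      }
    ; vanish = λ i k ne e → det-vanish _ i k ne (row e)
    }

-- Expanding the replaced row, every summand except the i-th repeats a row of `A`.
cramer : ∀ {n} (A : Mat n) i (z : Fin n → ℚ) →
         det (A [ i ≔ (λ j → Σᶠ (λ k → z k * A k j)) ]) ≡ z i * det A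
cramer {suc n} A i z = begin
  det (A [ i ≔ (λ j → Σᶠ (λ k → z k * A k j)) ])
    ≡⟨ row-sum det-multilinear A i z A ⟩
  Σᶠ (λ k → z k * det (A [ i ≔ A k ]))
    ≡⟨ Σ-remove i (λ k → z k * det (A [ i ≔ A k ])) ⟩
  z i * det (A [ i ≔ A i ]) + Σᶠ (λ k → z (punchIn i k) * det (A [ i ≔ A (punchIn i k) ]))
    ≡⟨ cong₂ _+_ (cong (z i *_) (det-resp (≔-id A i (A i) (λ _ → refl)))) (Σ-0 repeated) ⟩
  z i * det A + 0ℚ
    ≡⟨ +-identityʳ (z i * det A) ⟩
  z i * det A ∎
  where
  repeated : ∀ k → z (punchIn i k) * det (A [ i ≔ A (punchIn i k) ]) ≡ 0ℚ
  repeated k = trans (cong (z (punchIn i k) *_) (det-vanish (suc n) {A [ i ≔ A (punchIn i k) ]} i (punchIn i k) (punchInᵢ≢i i k ∘ sym)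
      (λ j → trans (≔-same A i (A (punchIn i k)) j) (sym (≔-off A i (A (punchIn i k)) (punchIn i k) (punchInᵢ≢i i k) j)))))
    (*-zeroʳ (z (punchIn i k)))

-- Moving row `i` to the top and expanding at column `i` cost the same sign, so a principal minor
-- carries none.
det-unit-row : ∀ {n} (A : Mat (suc n)) i →
               det (A [ i ≔ δ i ]) ≡ det (λ x y → A (punchIn i x) (punchIn i y))
det-unit-row A i = cancel-sign (toℕ i) (begin
  sign (toℕ i) * det M
    ≡⟨ move-to-front det-alternating i M ⟨
  det (M i ∷ᵛ (M ∘ punchIn i))
    ≡⟨ det-expand-unit i (M i ∷ᵛ (M ∘ punchIn i)) (≔-same A i (δ i)) ⟩
  sign (toℕ i) * det (λ x y → M (punchIn i x) (punchIn i y))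
    ≡⟨ cong (sign (toℕ i) *_) (det-resp (λ x y → ≔-off A i (δ i) (punchIn i x) (punchInᵢ≢i i x) (punchIn i y))) ⟩
  sign (toℕ i) * det (λ x y → A (punchIn i x) (punchIn i y)) ∎)
  where M = A [ i ≔ δ i ]

-- The identity with row `i` replaced by `w` has determinant `w i` by Cramer's rule, which evaluates
-- each term of the rank-one expansion.
det-δ+rank-one : ∀ {n} (c w : Fin n → ℚ) → det (δ +ᵣ c ⊠ w) ≡ 1ℚ + Σᶠ (λ i → c i * w i)
det-δ+rank-one {n} c w = trans (rank-one det-alternating δ c w)
  (cong₂ _+_ (det-δ n) (Σ-cong (λ i → cong (c i *_) (begin
    det (δ [ i ≔ w ])
      ≡⟨ det-resp (λ k j → unfold i k j) ⟩
    det (δ [ i ≔ (λ j → Σᶠ (λ k → w k * δ k j)) ])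
      ≡⟨ cramer δ i w ⟩
    w i * det (δ {n})
      ≡⟨ cong (w i *_) (det-δ n) ⟩
    w i * 1ℚ
      ≡⟨ *-identityʳ (w i) ⟩
    w i ∎))))
  where
  unfold : ∀ i → δ [ i ≔ w ] ≈ δ [ i ≔ (λ j → Σᶠ (λ k → w k * δ k j)) ]
  unfold i k j with k ≟ᶠ i
  ... | yes refl = trans (≔-same δ i w j) (sym (trans (≔-same δ i (λ j → Σᶠ (λ k → w k * δ k j)) j) (Σ-δʳ j w)))
  ... | no  k≢i  = ≔-≔-off δ i w (λ j → Σᶠ (λ k → w k * δ k j)) k k≢i j

-- Gram matrices

extend-self : ∀ {n} (k : Fin (suc n)) r → extend k r k ≡ 0ℚ
extend-self k r = Σ-0 (λ l → trans (cong (r l *_) (δ-≢ (punchInᵢ≢i k l))) (*-zeroʳ (r l)))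

extend-punchIn : ∀ {n} (k : Fin (suc n)) r x → extend k r (punchIn k x) ≡ r x
extend-punchIn k r x =
  trans (Σ-cong (λ l → cong (r l *_) (δ-inj (punchIn k) (punchIn-injective k _ _) l x))) (Σ-δʳ x r)

δ+rank-one-⊗ : ∀ {n} (c w : Fin n → ℚ) (A : Mat n) i j →
               ((δ +ᵣ c ⊠ w) ⊗ A) i j ≡ A i j + c i * Σᶠ (λ k → w k * A k j)
δ+rank-one-⊗ c w A i j = begin
  Σᶠ (λ k → (δ i k + c i * w k) * A k j)
    ≡⟨ Σ-cong (λ k → solve 4 (λ d c w a → (d :+ c :* w) :* a := d :* a :+ c :* (w :* a)) refl (δ i k) (c i) (w k) (A k j)) ⟩
  Σᶠ (λ k → δ i k * A k j + c i * (w k * A k j))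
    ≡⟨ Σ-+ (λ k → δ i k * A k j) (λ k → c i * (w k * A k j)) ⟩
  Σᶠ (λ k → δ i k * A k j) + Σᶠ (λ k → c i * (w k * A k j))
    ≡⟨ cong₂ _+_ (Σ-δˡ i (λ k → A k j)) (Σ-*ˡ (c i) (λ k → w k * A k j)) ⟩
  A i j + c i * Σᶠ (λ k → w k * A k j) ∎

⊗-δ+rank-one : ∀ {n} (c w : Fin n → ℚ) (A : Mat n) i j →
               (A ⊗ (δ +ᵣ c ⊠ w)) i j ≡ A i j + Σᶠ (λ k → A i k * c k) * w j
⊗-δ+rank-one c w A i j = begin
  Σᶠ (λ k → A i k * (δ k j + c k * w j))
    ≡⟨ Σ-cong (λ k → solve 4 (λ d c w a → a :* (d :+ c :* w) := a :* d :+ a :* c :* w) refl (δ k j) (c k) (w j) (A i k)) ⟩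
  Σᶠ (λ k → A i k * δ k j + A i k * c k * w j)
    ≡⟨ Σ-+ (λ k → A i k * δ k j) (λ k → A i k * c k * w j) ⟩
  Σᶠ (λ k → A i k * δ k j) + Σᶠ (λ k → A i k * c k * w j)
    ≡⟨ cong₂ _+_ (Σ-δʳ j (A i)) (Σ-*ʳ (w j) (λ k → A i k * c k)) ⟩
  A i j + Σᶠ (λ k → A i k * c k) * w j ∎

-- The product of the matrix with columns `v e` and its transpose, built as a sum of rank-one terms
-- so that each list element is one step of the induction.
gram : ∀ {X : Set} {n} → (X → Fin n → ℚ) → List X → Mat n
gram v []       i j = 0ℚ
gram v (e ∷ es) i j = v e i * v e j + gram v es i j

gram-cong : ∀ {X : Set} {m n} {v : X → Fin m → ℚ} {w : X → Fin n → ℚ} (f : Fin m → Fin n) →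
            (∀ e i → v e i ≡ w e (f i)) → ∀ es i j → gram v es i j ≡ gram w es (f i) (f j)
gram-cong f e []       i j = refl
gram-cong f e (x ∷ es) i j = cong₂ _+_ (cong₂ _*_ (e x i) (e x j)) (gram-cong f e es i j)

gram-map : ∀ {X Y : Set} {n} (v : Y → Fin n → ℚ) (f : X → Y) es → gram v (map f es) ≈ gram (v ∘ f) es
gram-map v f []       i j = refl
gram-map v f (x ∷ es) i j = cong (v (f x) i * v (f x) j +_) (gram-map v f es i j)

-- The linear map with matrix `δ +ᵣ c ⊠ δ i`. It has determinant 1 when `c i` is 0, and acts on a
-- Gram matrix by congruence.
shear : ∀ {n} → Fin n → (Fin n → ℚ) → (Fin n → ℚ) → Fin n → ℚ
shear i c b x = b x + c x * b i

gram-shear : ∀ {X : Set} {n} (v : X → Fin n → ℚ) i c es →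
             gram (λ e → shear i c (v e)) es ≈ (δ +ᵣ c ⊠ δ i) ⊗ (gram v es ⊗ (δ +ᵣ δ i ⊠ c))
gram-shear v i c es x y = begin
  gram (λ e → shear i c (v e)) es x y
    ≡⟨ explicit es ⟩
  (A x y + A x i * c y) + c x * (A i y + A i i * c y)
    ≡⟨ cong₂ (λ p q → p + c x * q) (inner x) (inner i) ⟩
  A' x y + c x * A' i y
    ≡⟨ cong (λ p → A' x y + c x * p) (Σ-δˡ i (λ k → A' k y)) ⟨
  A' x y + c x * Σᶠ (λ k → δ i k * A' k y)
    ≡⟨ δ+rank-one-⊗ c (δ i) A' x y ⟨
  ((δ +ᵣ c ⊠ δ i) ⊗ A') x y ∎
  where
  A = gram v es
  A' = A ⊗ (δ +ᵣ δ i ⊠ c)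
  inner : ∀ x → A x y + A x i * c y ≡ A' x y
  inner x = sym (trans (⊗-δ+rank-one (δ i) c A x y)
    (cong (λ p → A x y + p * c y) (trans (Σ-cong (λ k → cong (A x k *_) (δ-sym i k))) (Σ-δʳ i (A x)))))
  explicit : ∀ es → gram (λ e → shear i c (v e)) es x y ≡
             (gram v es x y + gram v es x i * c y) + c x * (gram v es i y + gram v es i i * c y)
  explicit []       = solve 2 (λ s t → con 0ℚ := (con 0ℚ :+ con 0ℚ :* s) :+ t :* (con 0ℚ :+ con 0ℚ :* s)) refl (c y) (c x)
  explicit (e ∷ es) = trans (cong (shear i c (v e) x * shear i c (v e) y +_) (explicit es))
    (solve 9 (λ bx by bi cx cy p q r s →
        (bx :+ cx :* bi) :* (by :+ cy :* bi) :+ ((p :+ q :* cy) :+ cx :* (r :+ s :* cy)) :=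
        ((bx :* by :+ p) :+ (bx :* bi :+ q) :* cy) :+ cx :* ((bi :* by :+ r) :+ (bi :* bi :+ s) :* cy)) refl
      (v e x) (v e y) (v e i) (c x) (c y) (gram v es x y) (gram v es x i) (gram v es i y) (gram v es i i))

det-gram-shear : ∀ {X : Set} {n} (v : X → Fin n → ℚ) i c → c i ≡ 0ℚ → ∀ es →
                 det (gram (λ e → shear i c (v e)) es) ≡ det (gram v es)
det-gram-shear {n = n} v i c ci≡0 es = begin
  det (gram (λ e → shear i c (v e)) es)
    ≡⟨ det-resp (gram-shear v i c es) ⟩
  det (P ⊗ (gram v es ⊗ P'))
    ≡⟨ trans (det-⊗ P (gram v es ⊗ P')) (cong (det P *_) (det-⊗ (gram v es) P')) ⟩
  det P * (det (gram v es) * det P')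
    ≡⟨ cong₂ (λ p q → p * (det (gram v es) * q)) detP detP' ⟩
  1ℚ * (det (gram v es) * 1ℚ)
    ≡⟨ solve 1 (λ x → con 1ℚ :* (x :* con 1ℚ) := x) refl (det (gram v es)) ⟩
  det (gram v es) ∎
  where
  P P' : Mat n
  P  = δ +ᵣ c ⊠ δ i
  P' = δ +ᵣ δ i ⊠ c
  detP' : det P' ≡ 1ℚ
  detP' = trans (det-δ+rank-one (δ i) c) (cong (1ℚ +_) (trans (Σ-δˡ i c) ci≡0))
  detP : det P ≡ 1ℚ
  detP = trans (det-δ+rank-one c (δ i))
    (cong (1ℚ +_) (trans (Σ-cong (λ k → cong (c k *_) (δ-sym i k))) (trans (Σ-δʳ i c) ci≡0)))

-- A shear followed by dropping coordinate `i`. For incidence vectors and a suitable `γ` it is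
-- contraction of an edge.
contractVec : ∀ {n} → Fin (suc n) → (Fin n → ℚ) → (Fin (suc n) → ℚ) → Fin n → ℚ
contractVec i γ b k = b (punchIn i k) + γ k * b i

punchIn-cases : ∀ {n} (i : Fin (suc n)) (P : Fin (suc n) → Set) → P i → (∀ k → P (punchIn i k)) → ∀ x → P x
punchIn-cases i P Pi Pk x with i ≟ᶠ x
... | yes refl = Pi
... | no  i≢x  = subst P (punchIn-punchOut i≢x) (Pk (punchOut i≢x))

-- A shear fixing the i-th coordinate turns v e into ± the i-th unit vector, so that e only affects
-- the (i , i) entry of the Gram matrix.
det-gram-contract : ∀ {X : Set} {n} (v : X → Fin (suc n) → ℚ) i γ e es →
                    v e i * v e i ≡ 1ℚ → (∀ k → contractVec i γ (v e) k ≡ 0ℚ) →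
                    det (gram v (e ∷ es)) ≡ det (gram v es) + det (gram (λ x → contractVec i γ (v x)) es)
det-gram-contract {X} {n} v i γ e es unit kill = begin
  det (gram v (e ∷ es))
    ≡⟨ det-gram-shear v i c c-self (e ∷ es) ⟨
  det (gram w (e ∷ es))
    -- Row `i` is the row of `G` plus a unit vector. The unit vector cuts out the principal minor of
    -- `G` at `i`, which is the Gram matrix of the contracted vectors.
    ≡⟨ det-linear i 1ℚ 1ℚ {gram w (e ∷ es)} {G} {G [ i ≔ δ i ]} off off' on ⟩
  1ℚ * det G + 1ℚ * det (G [ i ≔ δ i ])
    ≡⟨ cong₂ _+_ (trans (*-identityˡ (det G)) (det-gram-shear v i c c-self es))
         (trans (*-identityˡ (det (G [ i ≔ δ i ]))) (trans (det-unit-row G i)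
           (sym (det-resp (gram-cong {v = λ x → contractVec i γ (v x)} {w = w} (punchIn i) w-punchIn es))))) ⟩
  det (gram v es) + det (gram (λ x → contractVec i γ (v x)) es) ∎
  where
  c = extend i γ
  w : X → Fin (suc n) → ℚ
  w x = shear i c (v x)
  G = gram w es
  c-self = extend-self i γ
  w-punchIn : ∀ x k → contractVec i γ (v x) k ≡ w x (punchIn i k)
  w-punchIn x k = cong (λ t → v x (punchIn i k) + t * v x i) (sym (extend-punchIn i γ k))
  w-self : ∀ x → w x i ≡ v x i
  w-self x = trans (cong (λ t → v x i + t * v x i) c-self)
                   (solve 1 (λ b → b :+ con 0ℚ :* b := b) refl (v x i))
  w-kill : ∀ k → w e (punchIn i k) ≡ 0ℚ
  w-kill k = trans (sym (w-punchIn e k)) (kill k)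
  off : AgreeOff i (gram w (e ∷ es)) G
  off = punchIn-cases i (λ k → k ≢ i → ∀ j → w e k * w e j + G k j ≡ G k j)
    (λ i≢i → contradiction refl i≢i)
    (λ k _ j → trans (cong (λ t → t * w e j + G (punchIn i k) j) (w-kill k))
      (solve 2 (λ a b → con 0ℚ :* a :+ b := b) refl (w e j) (G (punchIn i k) j)))
  off' : AgreeOff i (gram w (e ∷ es)) (G [ i ≔ δ i ])
  off' k k≢i j = trans (off k k≢i j) (sym (≔-off G i (δ i) k k≢i j))
  unit-row : ∀ j → w e i * w e j ≡ δ i j
  unit-row = punchIn-cases i (λ j → w e i * w e j ≡ δ i j)
    (trans (cong₂ _*_ (w-self e) (w-self e)) (trans unit (sym (δ-refl i))))
    (λ k → trans (cong (w e i *_) (w-kill k)) (trans (*-zeroʳ (w e i)) (sym (δ-≢ (punchInᵢ≢i i k ∘ sym)))))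
  on : ∀ j → w e i * w e j + G i j ≡ 1ℚ * G i j + 1ℚ * (G [ i ≔ δ i ]) i j
  on j = trans (cong (_+ G i j) (unit-row j))
    (trans (solve 2 (λ a b → a :+ b := con 1ℚ :* b :+ con 1ℚ :* a) refl (δ i j) (G i j))
           (cong (λ t → 1ℚ * G i j + 1ℚ * t) (sym (≔-same G i (δ i) j))))

-- Connectivity and spanning trees under contraction

toT : ∀ {b} → b ≡ true → T b
toT = Equivalence.from T-≡

fromT : ∀ {b} → T b → b ≡ true
fromT = Equivalence.to T-≡

T⇔→≡ : ∀ {a b} → (T a → T b) → (T b → T a) → a ≡ b
T⇔→≡ f g = ⇔→≡ {z = true} (mk⇔ (fromT ∘ f ∘ toT) (fromT ∘ g ∘ toT))

anyᶠ⁺ : ∀ {n} (p : Fin n → Bool) l → T (p l) → T (anyᶠ p)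
anyᶠ⁺ p l pl = Any.any⁺ p (lose (∈-allFin l) pl)

anyᶠ⁻ : ∀ {n} (p : Fin n → Bool) → T (anyᶠ p) → ∃ (λ l → T (p l))
anyᶠ⁻ {n} p t = Any.satisfied (Any.any⁻ p (allFin n) t)

allᶠ⁺ : ∀ {n} (p : Fin n → Bool) → (∀ l → T (p l)) → T (allᶠ p)
allᶠ⁺ {n} p h = All.all⁻ p {xs = allFin n} (All.tabulate (λ {l} _ → h l))

allᶠ⁻ : ∀ {n} (p : Fin n → Bool) → T (allᶠ p) → ∀ l → T (p l)
allᶠ⁻ {n} p t l = All.lookup (All.all⁺ p (allFin n) t) (∈-allFin l)

-- Walks of bounded length

module _ {n} (a : Fin n → Fin n → Bool) where

  reach-refl : ∀ k i → T (reach a k i i)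
  reach-refl zero    i = fromWitness {a? = i ≟ᶠ i} refl
  reach-refl (suc k) i = Equivalence.from T-∨ (inj₁ (reach-refl k i))

  reach-step : ∀ k {i l j} → T (reach a k i l) → T (a l j) → T (reach a (suc k) i j)
  reach-step k {i} {l} {j} r e = Equivalence.from T-∨ (inj₂
    (anyᶠ⁺ (λ l → reach a k i l ∧ a l j) l (Equivalence.from T-∧ (r , e))))

  reach-unstep : ∀ k {i j} → T (reach a (suc k) i j) →
                 T (reach a k i j) ⊎ ∃ (λ l → T (reach a k i l) × T (a l j))
  reach-unstep k {i} {j} t with Equivalence.to T-∨ t
  ... | inj₁ r = inj₁ r
  ... | inj₂ s with anyᶠ⁻ (λ l → reach a k i l ∧ a l j) s
  ...   | l , u = inj₂ (l , Equivalence.to T-∧ u)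

  reach-invariant : ∀ {X : Set} (f : Fin n → X) → (∀ i j → T (a i j) → f i ≡ f j) →
                    ∀ k {i j} → T (reach a k i j) → f i ≡ f j
  reach-invariant f h zero    t = cong f (toWitness t)
  reach-invariant f h (suc k) t with reach-unstep k t
  ... | inj₁ r           = reach-invariant f h k r
  ... | inj₂ (l , r , e) = trans (reach-invariant f h k r) (h l _ e)

  -- The values are arbitrary because two kinds occur: booleans for colourings, rationals for the
  -- kernel of the Laplacian.
  connected-invariant : T (connectedᵇ a) → ∀ {X : Set} (f : Fin n → X) →
                        (∀ i j → T (a i j) → f i ≡ f j) → ∀ i j → f i ≡ f j
  connected-invariant c f h i j =
    reach-invariant f h n (allᶠ⁻ (reach a n i) (allᶠ⁻ (λ i → allᶠ (reach a n i)) c i) j)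

  module _ (i : Fin n) where

    ball : ℕ → Subset n
    ball k = tabulate (reach a k i)

    ∈-ball⁺ : ∀ k {j} → T (reach a k i j) → j ∈ˢ ball k
    ∈-ball⁺ k {j} t = lookup⇒[]= j (ball k) (trans (lookup∘tabulate (reach a k i) j) (fromT t))

    ∈-ball⁻ : ∀ k {j} → j ∈ˢ ball k → T (reach a k i j)
    ∈-ball⁻ k {j} m = toT (trans (sym (lookup∘tabulate (reach a k i) j)) ([]=⇒lookup m))

    Stable : ℕ → Set
    Stable k = ∀ {j} → T (reach a (suc k) i j) → T (reach a k i j)

    stable-suc : ∀ k → Stable k → Stable (suc k)
    stable-suc k st t with reach-unstep (suc k) t
    ... | inj₁ r           = r
    ... | inj₂ (l , r , e) = reach-step k (st r) e

    -- The ball of radius 0 contains `i`, and each step that is not yet stable adds a vertex.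
    stable-or-growing : ∀ k → Stable k ⊎ k ℕ.< ∣ ball k ∣
    stable-or-growing zero = inj₂ (ℕ.≤-<-trans z≤n
      (p⊂q⇒∣p∣<∣q∣ {p = ⊥} {q = ball 0} (⊥⊆ , i , ∈-ball⁺ 0 (reach-refl 0 i) , ∉⊥)))
    stable-or-growing (suc k) with stable-or-growing k
    ... | inj₁ st = inj₁ (stable-suc k st)
    ... | inj₂ k< with any? (λ j → T? (reach a (suc k) i j) ×-dec ¬? (T? (reach a k i j)))
    ...   | yes (j , new , old) = inj₂ (ℕ.<-≤-trans (s≤s k<)
              (p⊂q⇒∣p∣<∣q∣ ( (λ {x} m → ∈-ball⁺ (suc k) {x} (Equivalence.from T-∨ (inj₁ (∈-ball⁻ k m))))
                            , j , ∈-ball⁺ (suc k) new , old ∘ ∈-ball⁻ k)))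
    ...   | no  none = inj₁ (stable-suc k λ {j} t → decided j t)
      where
      decided : ∀ j → T (reach a (suc k) i j) → T (reach a k i j)
      decided j t with T? (reach a k i j)
      ... | yes r = r
      ... | no ¬r = contradiction (j , t , ¬r) none

    -- A ball has at most n elements, so at radius n growth is impossible: the length bound in
    -- `connectedᵇ` loses nothing.
    reach-closed : ∀ {l j} → T (reach a n i l) → T (a l j) → T (reach a n i j)
    reach-closed r e with stable-or-growing n
    ... | inj₁ st = st (reach-step n r e)
    ... | inj₂ n< = contradiction n< (ℕ.≤⇒≯ (∣p∣≤n (ball n)))

Edge : ℕ → Set
Edge n = Fin n × Fin n

-- Connectivity is expressed through 2-colourings: these pull back along contractions, walks do not.
Respects : ∀ {n} → (Fin n → Bool) → Edge n → Set
Respects f (a , b) = f a ≡ f b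

Joined : ∀ {n} → List (Edge n) → Set
Joined F = ∀ f → All (Respects f) F → ∀ i j → f i ≡ f j

==ᶠ⇒≡ : ∀ {n} {i j : Fin n} → T (i ==ᶠ j) → i ≡ j
==ᶠ⇒≡ = toWitness

==ᶠ-refl : ∀ {n} (i : Fin n) → T (i ==ᶠ i)
==ᶠ-refl i = fromWitness {a? = i ≟ᶠ i} refl

edgeAdj-respects : ∀ {n} (F : List (Edge n)) f → All (Respects f) F →
                   ∀ i j → T (edgeAdj F i j) → f i ≡ f j
edgeAdj-respects ((a , b) ∷ F) f (e ∷ es) i j t with Equivalence.to T-∨ t
... | inj₂ t' = edgeAdj-respects F f es i j t'
... | inj₁ t' with Equivalence.to T-∨ t'
...   | inj₁ u = let p , q = Equivalence.to T-∧ u in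
        trans (cong f (sym (==ᶠ⇒≡ p))) (trans e (cong f (==ᶠ⇒≡ q)))
...   | inj₂ u = let p , q = Equivalence.to T-∧ u in
        trans (cong f (sym (==ᶠ⇒≡ q))) (trans (sym e) (cong f (==ᶠ⇒≡ p)))

edgeAdj-edge : ∀ {n} (F : List (Edge n)) →
               All (λ e → T (edgeAdj F (proj₁ e) (proj₂ e)) × T (edgeAdj F (proj₂ e) (proj₁ e))) F
edgeAdj-edge []            = []
edgeAdj-edge ((a , b) ∷ F) =
  (Equivalence.from T-∨ (inj₁ forward) , Equivalence.from T-∨ (inj₁ backward))
  ∷ All.map (λ (p , q) → Equivalence.from T-∨ (inj₂ p) , Equivalence.from T-∨ (inj₂ q)) (edgeAdj-edge F)
  where
  loops : T ((a ==ᶠ a) ∧ (b ==ᶠ b))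
  loops = Equivalence.from T-∧ (==ᶠ-refl a , ==ᶠ-refl b)
  forward : T (((a ==ᶠ a) ∧ (b ==ᶠ b)) ∨ ((a ==ᶠ b) ∧ (b ==ᶠ a)))
  forward = Equivalence.from T-∨ (inj₁ loops)
  backward : T (((a ==ᶠ b) ∧ (b ==ᶠ a)) ∨ ((a ==ᶠ a) ∧ (b ==ᶠ b)))
  backward = Equivalence.from T-∨ (inj₂ loops)

connected⇒joined : ∀ {n} (F : List (Edge n)) → T (connectedᵇ (edgeAdj F)) → Joined F
connected⇒joined F c f es = connected-invariant (edgeAdj F) c f (edgeAdj-respects F f es)

-- Colour each vertex by whether it is reachable from `i`. The colouring respects every edge by
-- closure, and it is true at `i`, hence everywhere.
joined⇒connected : ∀ {n} (F : List (Edge n)) → Joined F → T (connectedᵇ (edgeAdj F))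
joined⇒connected {n} F J = allᶠ⁺ (λ i → allᶠ (reach a n i)) λ i → allᶠ⁺ (reach a n i) λ j →
  subst T (J (reach a n i)
             (All.map (λ (p , q) → T⇔→≡ (λ r → reach-closed a i r p) (λ r → reach-closed a i r q)) (edgeAdj-edge F))
             i j)
          (reach-refl a n i)
  where a = edgeAdj F

-- Merges `p` into `s` and renumbers by skipping `p`; a left inverse of `punchIn p`.
contract : ∀ {n} (p s : Fin (suc n)) → p ≢ s → Fin (suc n) → Fin n
contract p s p≢s x with p ≟ᶠ x
... | yes _   = punchOut p≢s
... | no  p≢x = punchOut p≢x

contract-punchIn : ∀ {n} p s (p≢s : p ≢ s) (y : Fin n) → contract p s p≢s (punchIn p y) ≡ y
contract-punchIn p s p≢s y with p ≟ᶠ punchIn p y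
... | yes e = contradiction (sym e) (punchInᵢ≢i p y)
... | no  _ = trans (punchOut-cong p refl) (punchOut-punchIn p)

contract-merge : ∀ {n} p s (p≢s : p ≢ s) → contract {n} p s p≢s p ≡ contract p s p≢s s
contract-merge p s p≢s with p ≟ᶠ p | p ≟ᶠ s
... | no ne | _     = contradiction refl ne
... | yes _ | yes e = contradiction e p≢s
... | yes _ | no ne = punchOut-cong p refl

mapEdge : ∀ {m n} → (Fin m → Fin n) → Edge m → Edge n
mapEdge c (a , b) = c a , c b

module _ {n} {p s : Fin (suc n)} (p≢s : p ≢ s) where

  private c = contract p s p≢s

  -- Colourings pull back along the contraction and give `p` and `s` one colour. The edge enters
  -- only through the colourings it admits, so `(p , s)` and `(s , p)` are treated alike.
  joined-contract : ∀ {e} → (∀ f → f p ≡ f s → Respects f e) →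
                    ∀ {F} → Joined (e ∷ F) → Joined (map (mapEdge c) F)
  joined-contract he {F} J f es i j = begin
    f i                   ≡⟨ cong f (contract-punchIn p s p≢s i) ⟨
    f (c (punchIn p i))   ≡⟨ J (f ∘ c) (he (f ∘ c) (cong f (contract-merge p s p≢s)) ∷ All.map⁻ es) (punchIn p i) (punchIn p j) ⟩
    f (c (punchIn p j))   ≡⟨ cong f (contract-punchIn p s p≢s j) ⟩
    f j                   ∎

  -- A colouring that respects `e` agrees at `p` and `s`, so it is recovered from its restriction to
  -- the vertices other than `p`.
  joined-uncontract : ∀ {e} → (∀ f → Respects f e → f p ≡ f s) →
                      ∀ {F} → Joined (map (mapEdge c) F) → Joined (e ∷ F)
  joined-uncontract he {F} J f (e ∷ es) i j = begin
    f i                   ≡⟨ back i ⟨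
    f (punchIn p (c i))   ≡⟨ J (f ∘ punchIn p) (All.map⁺ (All.map (λ {(a , b)} q → trans (back a) (trans q (sym (back b)))) es)) (c i) (c j) ⟩
    f (punchIn p (c j))   ≡⟨ back j ⟩
    f j                   ∎
    where
    back : ∀ x → f (punchIn p (c x)) ≡ f x
    back x with p ≟ᶠ x
    ... | no p≢x   = cong f (punchIn-punchOut p≢x)
    ... | yes refl = trans (cong f (punchIn-punchOut p≢s)) (sym (he f e))

joined⇒many-edges : ∀ n (F : List (Edge (suc n))) → Joined F → n ℕ.≤ length F
joined⇒many-edges zero    F  J = z≤n
-- With no edges, the colouring that singles out vertex `zero` is admissible but not constant.
joined⇒many-edges (suc n) [] J with J (λ { zero → true ; (suc _) → false }) [] zero (suc zero)
... | ()
joined⇒many-edges (suc n) ((a , b) ∷ F) J = [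
    (λ a≡b → ℕ.m≤n⇒m≤1+n (joined⇒many-edges (suc n) F (λ f es → J f (cong f a≡b ∷ es)))) ,
    (λ a≢b → s≤s (subst (n ℕ.≤_) (length-map (mapEdge (contract a b a≢b)) F)
      (joined⇒many-edges n (map (mapEdge (contract a b a≢b)) F) (joined-contract a≢b (λ _ → id) J)))) ]′
  (toSum (a ≟ᶠ b))

isSpanningTree-[] : ∀ n → isSpanningTree {suc (suc n)} [] ≡ false
isSpanningTree-[] n = ∧-zeroʳ _

isSpanningTree⁻ : ∀ {n} (F : List (Edge n)) → T (isSpanningTree F) → Joined F × length F ≡ n ∸ 1
isSpanningTree⁻ F t = let c , l = Equivalence.to T-∧ t in connected⇒joined F c , toWitness l

isSpanningTree⁺ : ∀ {n} (F : List (Edge n)) → Joined F → length F ≡ n ∸ 1 → T (isSpanningTree F)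
isSpanningTree⁺ {n} F J l = Equivalence.from T-∧ (joined⇒connected F J , fromWitness {a? = length F ℕ.≟ (n ∸ 1)} l)

-- Without the loop the list would still join all vertices, with one edge fewer than the lower
-- bound.
isSpanningTree-loop : ∀ {n} (a : Fin (suc n)) F → isSpanningTree ((a , a) ∷ F) ≡ false
isSpanningTree-loop {n} a F = T⇔→≡ {b = false} (λ t → let J , l = isSpanningTree⁻ ((a , a) ∷ F) t in
  ℕ.1+n≰n (subst (ℕ._≤ length F) (sym l) (joined⇒many-edges n F (λ f es → J f (refl ∷ es))))) (λ ())

isSpanningTree-contract : ∀ {n} {p s : Fin (suc (suc n))} (p≢s : p ≢ s) {e} →
  (∀ f → f p ≡ f s → Respects f e) → (∀ f → Respects f e → f p ≡ f s) →
  ∀ F → isSpanningTree (e ∷ F) ≡ isSpanningTree (map (mapEdge (contract p s p≢s)) F)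
isSpanningTree-contract p≢s {e} h h' F = T⇔→≡
  (λ t → let J , l = isSpanningTree⁻ (e ∷ F) t in
    isSpanningTree⁺ F' (joined-contract p≢s h J) (trans (length-map _ F) (ℕ.suc-injective l)))
  (λ t → let J , l = isSpanningTree⁻ F' t in
    isSpanningTree⁺ (e ∷ F) (joined-uncontract p≢s h' J) (cong suc (trans (sym (length-map _ F)) l)))
  where F' = map (mapEdge (contract _ _ p≢s)) F

-- Counting spanning trees among sublists

count : ∀ {A : Set} → (A → Bool) → List A → ℕ
count p xs = length (filterᵇ p xs)

count-++ : ∀ {A : Set} (p : A → Bool) xs ys → count p (xs ++ ys) ≡ count p xs ℕ.+ count p ys
count-++ p []       ys = refl
count-++ p (x ∷ xs) ys with p x
... | true  = cong suc (count-++ p xs ys)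
... | false = count-++ p xs ys

count-map : ∀ {A B : Set} (p : B → Bool) (f : A → B) xs → count p (map f xs) ≡ count (p ∘ f) xs
count-map p f []       = refl
count-map p f (x ∷ xs) with p (f x)
... | true  = cong suc (count-map p f xs)
... | false = count-map p f xs

count-cong : ∀ {A : Set} {p q : A → Bool} → (∀ x → p x ≡ q x) → ∀ xs → count p xs ≡ count q xs
count-cong {p = p} {q} e []       = refl
count-cong {p = p} {q} e (x ∷ xs) with p x | q x | e x
... | true  | true  | _ = cong suc (count-cong e xs)
... | false | false | _ = count-cong e xs

count-none : ∀ {A : Set} {p : A → Bool} → (∀ x → p x ≡ false) → ∀ xs → count p xs ≡ 0
count-none {p = p} e []       = refl
count-none {p = p} e (x ∷ xs) with p x | e x
... | false | _ = count-none e xs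

sublists-map : ∀ {A B : Set} (f : A → B) xs → sublists (map f xs) ≡ map (map f) (sublists xs)
sublists-map f []       = refl
sublists-map f (x ∷ xs) = begin
  map (f x ∷_) (sublists (map f xs)) ++ sublists (map f xs)
    ≡⟨ cong (λ s → map (f x ∷_) s ++ s) (sublists-map f xs) ⟩
  map (f x ∷_) (map (map f) (sublists xs)) ++ map (map f) (sublists xs)
    ≡⟨ cong (_++ map (map f) (sublists xs)) (trans (sym (map-∘ (sublists xs))) (map-∘ (sublists xs))) ⟩
  map (map f) (map (x ∷_) (sublists xs)) ++ map (map f) (sublists xs)
    ≡⟨ map-++ (map f) (map (x ∷_) (sublists xs)) (sublists xs) ⟨
  map (map f) (map (x ∷_) (sublists xs) ++ sublists xs) ∎

-- Unfolds to `τ G` on `edges G`. On lists with repetitions it counts by position, as is right for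
-- the parallel edges that contraction produces.
treeCount : ∀ {n} → List (Edge n) → ℕ
treeCount E = count isSpanningTree (sublists E)

treeCount-∷ : ∀ {n} (e : Edge n) E →
              treeCount (e ∷ E) ≡ count (isSpanningTree ∘ (e ∷_)) (sublists E) ℕ.+ treeCount E
treeCount-∷ e E = trans (count-++ isSpanningTree (map (e ∷_) (sublists E)) (sublists E))
  (cong (ℕ._+ treeCount E) (count-map isSpanningTree (e ∷_) (sublists E)))

treeCount-loop : ∀ {n} (a : Fin (suc n)) E → treeCount ((a , a) ∷ E) ≡ treeCount E
treeCount-loop a E = trans (treeCount-∷ (a , a) E)
  (cong (ℕ._+ treeCount E) (count-none (isSpanningTree-loop a) (sublists E)))

treeCount-contract : ∀ {n} {p s : Fin (suc (suc n))} (p≢s : p ≢ s) {e} →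
  (∀ f → f p ≡ f s → Respects f e) → (∀ f → Respects f e → f p ≡ f s) →
  ∀ E → treeCount (e ∷ E) ≡ treeCount (map (mapEdge (contract p s p≢s)) E) ℕ.+ treeCount E
treeCount-contract p≢s {e} h h' E = trans (treeCount-∷ e E) (cong (ℕ._+ treeCount E) (begin
  count (isSpanningTree ∘ (e ∷_)) (sublists E)
    ≡⟨ count-cong (isSpanningTree-contract p≢s h h') (sublists E) ⟩
  count (isSpanningTree ∘ map c) (sublists E)
    ≡⟨ count-map isSpanningTree (map c) (sublists E) ⟨
  count isSpanningTree (map (map c) (sublists E))
    ≡⟨ cong (count isSpanningTree) (sublists-map c E) ⟨
  treeCount (map c E) ∎))
  where
  c = mapEdge (contract _ _ p≢s)

-- The matrix-tree theorem

fromℕ-suc : ∀ k → fromℕ (suc k) ≡ 1ℚ + fromℕ k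
fromℕ-suc k = begin
  -- Addition in ℚ cross-multiplies, so the numerator must be brought to the shape 1 · 1 + k · 1.
  -- The explicit `mkℚ` lets the sum compute, which `fromℕ k`, being normalised by a gcd, does not.
  fromℕ (suc k)                                           ≡⟨ cong (λ z → ℤ.+ (suc z) / 1) (sym (ℕ.*-identityʳ k)) ⟩
  (ℤ.+ 1 ℤ.* ℤ.+ 1 ℤ.+ (ℤ.+ (k ℕ.* 1))) / 1                     ≡⟨ cong (λ z → (ℤ.+ 1 ℤ.+ z) / 1) (ℤ.pos-* k 1) ⟩
  1ℚ + mkℚ (ℤ.+ k) 0 coprime                                ≡⟨ cong (1ℚ +_) (normalize-coprime coprime) ⟨
  1ℚ + fromℕ k                                            ∎
  where
  coprime = coprime-sym (1-coprimeTo k)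

fromℕ-+ : ∀ a b → fromℕ (a ℕ.+ b) ≡ fromℕ a + fromℕ b
fromℕ-+ zero    b = sym (+-identityˡ (fromℕ b))
fromℕ-+ (suc a) b = begin
  fromℕ (suc (a ℕ.+ b))        ≡⟨ fromℕ-suc (a ℕ.+ b) ⟩
  1ℚ + fromℕ (a ℕ.+ b)         ≡⟨ cong (1ℚ +_) (fromℕ-+ a b) ⟩
  1ℚ + (fromℕ a + fromℕ b)     ≡⟨ +-assoc 1ℚ (fromℕ a) (fromℕ b) ⟨
  1ℚ + fromℕ a + fromℕ b       ≡⟨ cong (_+ fromℕ b) (fromℕ-suc a) ⟨
  fromℕ (suc a) + fromℕ b      ∎

incidence : ∀ {n} → Edge n → Fin n → ℚ
incidence (a , b) x = δ a x - δ b x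

-- The incidence vector without the coordinate of `r`; the Gram matrix of these is the reduced
-- Laplacian.
grounded : ∀ {n} → Fin (suc n) → Edge (suc n) → Fin n → ℚ
grounded r e k = incidence e (punchIn r k)

module _ {n} (r : Fin (suc (suc n))) (i : Fin (suc n)) (s : Fin (suc (suc n))) (p≢s : punchIn r i ≢ s) where

  private
    p = punchIn r i
    -- The index of the ground `r` once `p` is removed. Below, `γ` is the unit vector of `s` among
    -- the remaining ungrounded coordinates, and it is zero when `s` is the ground itself.
    r' = pinch i r
    c = contract p s p≢s
    γ : Fin n → ℚ
    γ k = δ (c s) (punchIn r' k)

  -- On unit vectors, merging `p` into `s` adds coordinate `p` to coordinate `s`. By linearity the
  -- algebraic contraction of an incidence vector is then the incidence vector of the contracted
  -- edge.
  δ-contract : ∀ x k → δ (c x) (punchIn r' k) ≡ δ x (punchIn r (punchIn i k)) + γ k * δ x p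
  δ-contract = punchIn-cases p (λ x → ∀ k → δ (c x) (punchIn r' k) ≡ δ x (punchIn r (punchIn i k)) + γ k * δ x p)
    (λ k → begin
      δ (c p) (punchIn r' k)
        ≡⟨ cong (λ y → δ y (punchIn r' k)) (contract-merge p s p≢s) ⟩
      γ k
        ≡⟨ solve 1 (λ g → g := con 0ℚ :+ g :* con 1ℚ) refl (γ k) ⟩
      0ℚ + γ k * 1ℚ
        ≡⟨ cong₂ (λ y z → y + γ k * z) (δ-≢ (punchInᵢ≢i i k ∘ sym ∘ punchIn-injective r i (punchIn i k))) (δ-refl p) ⟨
      δ p (punchIn r (punchIn i k)) + γ k * δ p p ∎)
    (λ y k → begin
      δ (c (punchIn p y)) (punchIn r' k)
        ≡⟨ cong (λ z → δ z (punchIn r' k)) (contract-punchIn p s p≢s y) ⟩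
      δ y (punchIn r' k)
        ≡⟨ δ-inj (punchIn p) (punchIn-injective p _ _) y (punchIn r' k) ⟨
      δ (punchIn p y) (punchIn p (punchIn r' k))
        ≡⟨ cong (δ (punchIn p y)) (punchIn-punchIn r i k) ⟩
      δ (punchIn p y) (punchIn r (punchIn i k))
        ≡⟨ solve 2 (λ d g → d := d :+ g :* con 0ℚ) refl (δ (punchIn p y) (punchIn r (punchIn i k))) (γ k) ⟩
      δ (punchIn p y) (punchIn r (punchIn i k)) + γ k * 0ℚ
        ≡⟨ cong (λ z → δ (punchIn p y) (punchIn r (punchIn i k)) + γ k * z) (δ-≢ (punchInᵢ≢i p y)) ⟨
      δ (punchIn p y) (punchIn r (punchIn i k)) + γ k * δ (punchIn p y) p ∎)

  grounded-contract : ∀ e k → grounded r' (mapEdge c e) k ≡ contractVec i γ (grounded r e) k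
  grounded-contract (a , b) k = trans (cong₂ _-_ (δ-contract a k) (δ-contract b k))
    (solve 5 (λ x y z w g → (x :+ g :* y) :+ :- (z :+ g :* w) := (x :+ :- z) :+ g :* (y :+ :- w)) refl
      (δ a (punchIn r (punchIn i k))) (δ a p) (δ b (punchIn r (punchIn i k))) (δ b p) (γ k))

  -- The hypotheses on `e` are those shared by both orientations of the edge. Its image under
  -- contraction is a loop, with zero incidence vector, as the Gram contraction requires.
  matrix-tree-step : ∀ e → grounded r e i * grounded r e i ≡ 1ℚ →
    (∀ f → f p ≡ f s → Respects f e) → (∀ f → Respects f e → f p ≡ f s) → c (proj₁ e) ≡ c (proj₂ e) → ∀ E →
    det (gram (grounded r) E) ≡ fromℕ (treeCount E) →
    det (gram (grounded r') (map (mapEdge c) E)) ≡ fromℕ (treeCount (map (mapEdge c) E)) →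
    det (gram (grounded r) (e ∷ E)) ≡ fromℕ (treeCount (e ∷ E))
  matrix-tree-step e unit h h' ce E ih ih' = begin
    det (gram (grounded r) (e ∷ E))
      ≡⟨ det-gram-contract (grounded r) i γ e E unit kill ⟩
    det (gram (grounded r) E) + det (gram (λ x → contractVec i γ (grounded r x)) E)
      ≡⟨ cong₂ _+_ ih (trans (det-resp contracted) ih') ⟩
    fromℕ (treeCount E) + fromℕ (treeCount (map (mapEdge c) E))
      ≡⟨ +-comm (fromℕ (treeCount E)) (fromℕ (treeCount (map (mapEdge c) E))) ⟩
    fromℕ (treeCount (map (mapEdge c) E)) + fromℕ (treeCount E)
      ≡⟨ fromℕ-+ (treeCount (map (mapEdge c) E)) (treeCount E) ⟨
    fromℕ (treeCount (map (mapEdge c) E) ℕ.+ treeCount E)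
      ≡⟨ cong fromℕ (treeCount-contract p≢s {e} h h' E) ⟨
    fromℕ (treeCount (e ∷ E)) ∎
    where
    kill : ∀ k → contractVec i γ (grounded r e) k ≡ 0ℚ
    kill k = trans (sym (grounded-contract e k))
      (trans (cong (λ z → δ z (punchIn r' k) - δ (c (proj₂ e)) (punchIn r' k)) ce)
             (+-inverseʳ (δ (c (proj₂ e)) (punchIn r' k))))
    contracted : gram (λ x → contractVec i γ (grounded r x)) E ≈ gram (grounded r') (map (mapEdge c) E)
    contracted x y = trans
      (gram-cong {v = λ x → contractVec i γ (grounded r x)} {w = grounded r' ∘ mapEdge c} (λ k → k)
        (λ e k → sym (grounded-contract e k)) E x y)
      (sym (gram-map (grounded r') (mapEdge c) E x y))

  matrix-tree-forward : ∀ E →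
    det (gram (grounded r) E) ≡ fromℕ (treeCount E) →
    det (gram (grounded r') (map (mapEdge c) E)) ≡ fromℕ (treeCount (map (mapEdge c) E)) →
    det (gram (grounded r) ((p , s) ∷ E)) ≡ fromℕ (treeCount ((p , s) ∷ E))
  matrix-tree-forward = matrix-tree-step (p , s)
    (cong₂ (λ x y → (x - y) * (x - y)) (δ-refl p) (δ-≢ (p≢s ∘ sym)))
    (λ f q → q) (λ f q → q) (contract-merge p s p≢s)

  matrix-tree-backward : ∀ E →
    det (gram (grounded r) E) ≡ fromℕ (treeCount E) →
    det (gram (grounded r') (map (mapEdge c) E)) ≡ fromℕ (treeCount (map (mapEdge c) E)) →
    det (gram (grounded r) ((s , p) ∷ E)) ≡ fromℕ (treeCount ((s , p) ∷ E))
  matrix-tree-backward = matrix-tree-step (s , p)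
    (cong₂ (λ x y → (y - x) * (y - x)) (δ-refl p) (δ-≢ (p≢s ∘ sym)))
    (λ f → sym) (λ f → sym) (sym (contract-merge p s p≢s))

matrix-tree-loop : ∀ {n} (a : Fin (suc n)) E r → det (gram (grounded r) E) ≡ fromℕ (treeCount E) →
                   det (gram (grounded r) ((a , a) ∷ E)) ≡ fromℕ (treeCount ((a , a) ∷ E))
matrix-tree-loop a E r ih = trans (det-resp drop) (trans ih (cong fromℕ (sym (treeCount-loop a E))))
  where
  drop : gram (grounded r) ((a , a) ∷ E) ≈ gram (grounded r) E
  drop i j = solve 3 (λ x y g → (x :+ :- x) :* (y :+ :- y) :+ g := g) refl
               (δ a (punchIn r i)) (δ a (punchIn r j)) (gram (grounded r) E i j)

treeCount-[] : ∀ n → treeCount {suc (suc n)} [] ≡ 0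
treeCount-[] n with isSpanningTree {suc (suc n)} [] | isSpanningTree-[] n
... | false | refl = refl

MatrixTree : ∀ {n} → List (Edge (suc n)) → Fin (suc n) → Set
MatrixTree E r = det (gram (grounded r) E) ≡ fromℕ (treeCount E)

-- Deletion shortens the list and contraction lowers the number of vertices. On a single vertex the
-- empty list is the one tree, matching the 0 × 0 determinant.
matrix-tree : ∀ n (E : List (Edge (suc n))) r → MatrixTree E r
matrix-tree zero    []                   r = refl
matrix-tree (suc n) []                   r =
  trans (row-zero det-multilinear {gram (grounded r) []} zero (λ _ → refl)) (cong fromℕ (sym (treeCount-[] n)))
matrix-tree zero    ((zero , zero) ∷ E)  r = matrix-tree-loop zero E r (matrix-tree zero E r)
matrix-tree (suc n) ((a , b) ∷ E)        r = [
  (λ a≡b → subst (λ b → MatrixTree ((a , b) ∷ E) r) a≡b (matrix-tree-loop a E r (matrix-tree (suc n) E r))) ,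
  (λ a≢b → [
    -- The merged vertex must own a coordinate, which the ground does not: if `a` is the ground, `b`
    -- is merged into it, otherwise `a` is merged into `b`. The `subst` writes the merged vertex as
    -- `punchIn r` of a reduced index.
    (λ r≡a → subst (λ a → a ≢ b → MatrixTree ((a , b) ∷ E) r) r≡a
      (λ r≢b → subst (λ b → r ≢ b → MatrixTree ((r , b) ∷ E) r) (punchIn-punchOut r≢b)
        (λ r≢p → matrix-tree-backward r (punchOut r≢b) r (r≢p ∘ sym) E (matrix-tree (suc n) E r)
                   (matrix-tree n (map (mapEdge (contract _ r (r≢p ∘ sym))) E) (pinch (punchOut r≢b) r)))
        r≢b)
      a≢b) ,
    (λ r≢a → subst (λ a → a ≢ b → MatrixTree ((a , b) ∷ E) r) (punchIn-punchOut r≢a)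
      (λ p≢b → matrix-tree-forward r (punchOut r≢a) b p≢b E (matrix-tree (suc n) E r)
                 (matrix-tree n (map (mapEdge (contract _ b p≢b)) E) (pinch (punchOut r≢a) r)))
      a≢b) ]′
    (toSum (r ≟ᶠ a))) ]′
  (toSum (a ≟ᶠ b))

-- The Laplacian as a Gram matrix

Σˡ : ∀ {X : Set} → (X → ℚ) → List X → ℚ
Σˡ f []       = 0ℚ
Σˡ f (x ∷ xs) = f x + Σˡ f xs

Σˡ-++ : ∀ {X : Set} (f : X → ℚ) xs ys → Σˡ f (xs ++ ys) ≡ Σˡ f xs + Σˡ f ys
Σˡ-++ f []       ys = sym (+-identityˡ (Σˡ f ys))
Σˡ-++ f (x ∷ xs) ys = trans (cong (f x +_) (Σˡ-++ f xs ys)) (sym (+-assoc (f x) (Σˡ f xs) (Σˡ f ys)))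

Σˡ-map : ∀ {X Y : Set} (f : Y → ℚ) (g : X → Y) xs → Σˡ f (map g xs) ≡ Σˡ (f ∘ g) xs
Σˡ-map f g []       = refl
Σˡ-map f g (x ∷ xs) = cong (f (g x) +_) (Σˡ-map f g xs)

Σˡ-concatMap : ∀ {X Y : Set} (f : Y → ℚ) (g : X → List Y) xs → Σˡ f (concatMap g xs) ≡ Σˡ (λ x → Σˡ f (g x)) xs
Σˡ-concatMap f g []       = refl
Σˡ-concatMap f g (x ∷ xs) = trans (Σˡ-++ f (g x) (concatMap g xs)) (cong (Σˡ f (g x) +_) (Σˡ-concatMap f g xs))

Σˡ-0 : ∀ {X : Set} {f : X → ℚ} → (∀ x → f x ≡ 0ℚ) → ∀ xs → Σˡ f xs ≡ 0ℚ
Σˡ-0 e []       = refl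
Σˡ-0 e (x ∷ xs) = trans (cong₂ _+_ (e x) (Σˡ-0 e xs)) (+-identityˡ 0ℚ)

Σˡ-tabulate : ∀ {X : Set} {n} (f : X → ℚ) (g : Fin n → X) → Σˡ f (tabulateˡ g) ≡ Σᶠ (f ∘ g)
Σˡ-tabulate {n = zero}  f g = refl
Σˡ-tabulate {n = suc n} f g = cong (f (g zero) +_) (Σˡ-tabulate f (g ∘ suc))

indicator : Bool → ℚ
indicator b = if b then 1ℚ else 0ℚ

Σˡ-filter : ∀ {X : Set} (f : X → ℚ) (p : X → Bool) xs → Σˡ f (filterᵇ p xs) ≡ Σˡ (λ x → indicator (p x) * f x) xs
Σˡ-filter f p []       = refl
Σˡ-filter f p (x ∷ xs) with p x
... | true  = cong₂ _+_ (sym (*-identityˡ (f x))) (Σˡ-filter f p xs)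
... | false = trans (Σˡ-filter f p xs) (sym (trans (cong (_+ rest) (*-zeroˡ (f x))) (+-identityˡ rest)))
  where rest = Σˡ (λ x → indicator (p x) * f x) xs

gram-as-Σ : ∀ {X : Set} {n} (v : X → Fin n → ℚ) es i j → gram v es i j ≡ Σˡ (λ e → v e i * v e j) es
gram-as-Σ v []       i j = refl
gram-as-Σ v (e ∷ es) i j = cong (v e i * v e j +_) (gram-as-Σ v es i j)

gram-sym : ∀ {X : Set} {n} (v : X → Fin n → ℚ) es i j → gram v es i j ≡ gram v es j i
gram-sym v []       i j = refl
gram-sym v (e ∷ es) i j = cong₂ _+_ (*-comm (v e i) (v e j)) (gram-sym v es i j)

-- Quadratic form and kernel of a Gram matrix

gram-apply : ∀ {X : Set} {n} (v : X → Fin n → ℚ) (x : Fin n → ℚ) es i →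
             Σᶠ (λ j → gram v es i j * x j) ≡ Σˡ (λ e → v e i * Σᶠ (λ j → v e j * x j)) es
gram-apply v x []       i = Σ-0 (λ j → *-zeroˡ (x j))
gram-apply v x (e ∷ es) i = begin
  Σᶠ (λ j → (v e i * v e j + gram v es i j) * x j)
    ≡⟨ Σ-cong (λ j → solve 4 (λ a b g x → (a :* b :+ g) :* x := a :* (b :* x) :+ g :* x) refl (v e i) (v e j) (gram v es i j) (x j)) ⟩
  Σᶠ (λ j → v e i * (v e j * x j) + gram v es i j * x j)
    ≡⟨ Σ-+ (λ j → v e i * (v e j * x j)) (λ j → gram v es i j * x j) ⟩
  Σᶠ (λ j → v e i * (v e j * x j)) + Σᶠ (λ j → gram v es i j * x j)
    ≡⟨ cong₂ _+_ (Σ-*ˡ (v e i) (λ j → v e j * x j)) (gram-apply v x es i) ⟩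
  v e i * Σᶠ (λ j → v e j * x j) + Σˡ (λ e → v e i * Σᶠ (λ j → v e j * x j)) es ∎

gram-energy : ∀ {X : Set} {n} (v : X → Fin n → ℚ) (x : Fin n → ℚ) es →
              Σᶠ (λ i → x i * Σˡ (λ e → v e i * Σᶠ (λ j → v e j * x j)) es) ≡
              Σˡ (λ e → Σᶠ (λ j → v e j * x j) * Σᶠ (λ j → v e j * x j)) es
gram-energy v x []       = Σ-0 (λ i → *-zeroʳ (x i))
gram-energy v x (e ∷ es) = begin
  Σᶠ (λ i → x i * (v e i * d + h i))
    ≡⟨ Σ-cong (λ i → solve 4 (λ x a d h → x :* (a :* d :+ h) := a :* x :* d :+ x :* h) refl (x i) (v e i) d (h i)) ⟩
  Σᶠ (λ i → v e i * x i * d + x i * h i)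
    ≡⟨ Σ-+ (λ i → v e i * x i * d) (λ i → x i * h i) ⟩
  Σᶠ (λ i → v e i * x i * d) + Σᶠ (λ i → x i * h i)
    ≡⟨ cong₂ _+_ (Σ-*ʳ d (λ i → v e i * x i)) (gram-energy v x es) ⟩
  d * d + Σˡ (λ e → Σᶠ (λ j → v e j * x j) * Σᶠ (λ j → v e j * x j)) es ∎
  where
  d = Σᶠ (λ j → v e j * x j)
  h : Fin _ → ℚ
  h i = Σˡ (λ e → v e i * Σᶠ (λ j → v e j * x j)) es

square-nonneg : ∀ a → 0ℚ ≤ a * a
square-nonneg a with <-cmp a 0ℚ
... | tri< a<0 _ _  = <⇒≤ (positive⁻¹ (a * a) {{neg*neg⇒pos a {{negative a<0}} a {{negative a<0}}}})
... | tri≈ _ refl _ = ≤-refl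
... | tri> _ _ a>0  = <⇒≤ (positive⁻¹ (a * a) {{pos*pos⇒pos a {{positive a>0}} a {{positive a>0}}}})

squares-nonneg : ∀ {X : Set} (f : X → ℚ) xs → 0ℚ ≤ Σˡ (λ x → f x * f x) xs
squares-nonneg f []       = ≤-refl
squares-nonneg f (x ∷ xs) = +-mono-≤ (square-nonneg (f x)) (squares-nonneg f xs)

nonneg-sum-zero : ∀ {a b} → 0ℚ ≤ a → 0ℚ ≤ b → a + b ≡ 0ℚ → a ≡ 0ℚ × b ≡ 0ℚ
nonneg-sum-zero {a} {b} a≥0 b≥0 e =
    ≤-antisym (subst (a ≤_) e (subst (_≤ a + b) (+-identityʳ a) (+-monoʳ-≤ a b≥0))) a≥0
  , ≤-antisym (subst (b ≤_) e (subst (_≤ a + b) (+-identityˡ b) (+-monoˡ-≤ b a≥0))) b≥0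

square-zero : ∀ a → a * a ≡ 0ℚ → a ≡ 0ℚ
square-zero a e with <-cmp a 0ℚ
... | tri< a<0 _ _ = contradiction (positive⁻¹ (a * a) {{neg*neg⇒pos a {{negative a<0}} a {{negative a<0}}}}) (<-irrefl (sym e))
... | tri≈ _ a≡0 _ = a≡0
... | tri> _ _ a>0 = contradiction (positive⁻¹ (a * a) {{pos*pos⇒pos a {{positive a>0}} a {{positive a>0}}}}) (<-irrefl (sym e))

squares-zero : ∀ {X : Set} (f : X → ℚ) xs → Σˡ (λ x → f x * f x) xs ≡ 0ℚ → All (λ x → f x ≡ 0ℚ) xs
squares-zero f []       e = []
squares-zero f (x ∷ xs) e =
  let p , q = nonneg-sum-zero (square-nonneg (f x)) (squares-nonneg f xs) e
  in square-zero (f x) p ∷ squares-zero f xs q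

-- The quadratic form at a kernel vector is zero, and it is the sum of the squares of these
-- pairings.
gram-kernel : ∀ {X : Set} {n} (v : X → Fin n → ℚ) (x : Fin n → ℚ) es →
              (∀ i → Σᶠ (λ j → gram v es i j * x j) ≡ 0ℚ) → All (λ e → Σᶠ (λ j → v e j * x j) ≡ 0ℚ) es
gram-kernel v x es k = squares-zero (λ e → Σᶠ (λ j → v e j * x j)) es (begin
  Σˡ (λ e → Σᶠ (λ j → v e j * x j) * Σᶠ (λ j → v e j * x j)) es
    ≡⟨ gram-energy v x es ⟨
  Σᶠ (λ i → x i * Σˡ (λ e → v e i * Σᶠ (λ j → v e j * x j)) es)
    ≡⟨ Σ-0 (λ i → trans (cong (x i *_) (trans (sym (gram-apply v x es i)) (k i))) (*-zeroʳ (x i))) ⟩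
  0ℚ ∎)

incidence-apply : ∀ {n} (e : Edge n) (x : Fin n → ℚ) →
                  Σᶠ (λ j → incidence e j * x j) ≡ x (proj₁ e) - x (proj₂ e)
incidence-apply (a , b) x = begin
  Σᶠ (λ j → (δ a j - δ b j) * x j)
    ≡⟨ Σ-cong (λ j → solve 3 (λ p q x → (p :+ :- q) :* x := p :* x :+ :- (q :* x)) refl (δ a j) (δ b j) (x j)) ⟩
  Σᶠ (λ j → δ a j * x j + - (δ b j * x j))
    ≡⟨ Σ-+ (λ j → δ a j * x j) (λ j → - (δ b j * x j)) ⟩
  Σᶠ (λ j → δ a j * x j) + Σᶠ (λ j → - (δ b j * x j))
    ≡⟨ cong₂ _+_ (Σ-δˡ a x) (trans (Σ-neg (λ j → δ b j * x j)) (cong -_ (Σ-δˡ b x))) ⟩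
  x a - x b ∎

module _ {n} (G : Graph n) where

  adjacency : Fin n → Fin n → ℚ
  adjacency i j = indicator (adj G i j)

  private
    w : Fin n → Fin n → ℚ
    w i j = indicator (⌊ toℕ i ℕ.<? toℕ j ⌋ ∧ adj G i j)

  -- `w` records the pairs that occur in `edges G`: each edge in exactly one orientation, from the
  -- smaller to the larger vertex.
  w-symmetrise : ∀ i j → w i j + w j i ≡ adjacency i j
  w-symmetrise i j with toℕ i ℕ.<? toℕ j | toℕ j ℕ.<? toℕ i
  ... | yes i<j | yes j<i = contradiction j<i (ℕ.<-asym i<j)
  ... | yes _   | no  _   = +-identityʳ (adjacency i j)
  ... | no  _   | yes _   = trans (+-identityˡ (adjacency j i)) (cong indicator (adj-sym G j i))
  ... | no  i≮j | no  j≮i with toℕ-injective (ℕ.≤-antisym (ℕ.≮⇒≥ j≮i) (ℕ.≮⇒≥ i≮j))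
  ...   | refl = cong indicator (sym (irrefl G i))

  laplacian-entry : ∀ i j → laplacian G i j ≡ δ i j * degree G i - adjacency i j
  laplacian-entry i j with i ≟ᶠ j
  ... | yes refl = sym (trans (cong (λ b → 1ℚ * degree G i - indicator b) (irrefl G i))
                     (solve 1 (λ d → con 1ℚ :* d :+ :- con 0ℚ := d) refl (degree G i)))
  ... | no _ with adj G i j
  ...   | true  = solve 1 (λ d → con (- 1ℚ) := con 0ℚ :* d :+ :- con 1ℚ) refl (degree G i)
  ...   | false = solve 1 (λ d → con 0ℚ := con 0ℚ :* d :+ :- con 0ℚ) refl (degree G i)

  edges-sum : (f : Edge n → ℚ) → Σˡ f (edges G) ≡ Σᶠ (λ a → Σᶠ (λ b → w a b * f (a , b)))
  edges-sum f = begin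
    Σˡ f (edges G)
      ≡⟨ Σˡ-filter f _ pairs ⟩
    Σˡ g pairs
      ≡⟨ Σˡ-concatMap g (λ a → map (a ,_) (allFin n)) (allFin n) ⟩
    Σˡ (λ a → Σˡ g (map (a ,_) (allFin n))) (allFin n)
      ≡⟨ Σˡ-tabulate (λ a → Σˡ g (map (a ,_) (allFin n))) (λ a → a) ⟩
    Σᶠ (λ a → Σˡ g (map (a ,_) (allFin n)))
      ≡⟨ Σ-cong (λ a → trans (Σˡ-map g (a ,_) (allFin n)) (Σˡ-tabulate (λ b → g (a , b)) (λ b → b))) ⟩
    Σᶠ (λ a → Σᶠ (λ b → w a b * f (a , b))) ∎
    where
    pairs = concatMap (λ a → map (a ,_) (allFin n)) (allFin n)
    g : Edge n → ℚ
    g (a , b) = w a b * f (a , b)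

  -- Of the four products of unit vectors from each edge, the two squares add up to the out-degree
  -- and the in-degree of `i`, hence to its degree; the two mixed ones give minus the adjacency.
  laplacian-gram : ∀ i j → laplacian G i j ≡ gram incidence (edges G) i j
  laplacian-gram i j = sym (begin
    gram incidence (edges G) i j
      ≡⟨ gram-as-Σ incidence (edges G) i j ⟩
    Σˡ (λ e → incidence e i * incidence e j) (edges G)
      ≡⟨ edges-sum (λ e → incidence e i * incidence e j) ⟩
    Σᶠ (λ a → Σᶠ (λ b → w a b * ((δ a i - δ b i) * (δ a j - δ b j))))
      ≡⟨ Σ-cong inner ⟩
    Σᶠ (λ a → (out a * δ a j) * δ a i + - (w a j) * δ a i + (- (w a i) * δ a j + w a i * δ i j))
      ≡⟨ trans (Σ-+ (λ a → (out a * δ a j) * δ a i + - (w a j) * δ a i) (λ a → - (w a i) * δ a j + w a i * δ i j))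
           (cong₂ _+_ (Σ-+ (λ a → (out a * δ a j) * δ a i) (λ a → - (w a j) * δ a i))
                      (Σ-+ (λ a → - (w a i) * δ a j) (λ a → w a i * δ i j))) ⟩
    Σᶠ (λ a → (out a * δ a j) * δ a i) + Σᶠ (λ a → - (w a j) * δ a i) +
    (Σᶠ (λ a → - (w a i) * δ a j) + Σᶠ (λ a → w a i * δ i j))
      ≡⟨ cong₂ _+_ (cong₂ _+_ (Σ-δʳ i (λ a → out a * δ a j)) (Σ-δʳ i (λ a → - (w a j))))
                   (cong₂ _+_ (Σ-δʳ j (λ a → - (w a i))) (Σ-*ʳ (δ i j) (λ a → w a i))) ⟩
    out i * δ i j + - (w i j) + (- (w j i) + into * δ i j)
      ≡⟨ solve 5 (λ o d p q t → o :* d :+ :- p :+ (:- q :+ t :* d) := d :* (o :+ t) :+ :- (p :+ q)) refl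
           (out i) (δ i j) (w i j) (w j i) into ⟩
    δ i j * (out i + into) - (w i j + w j i)
      ≡⟨ cong₂ (λ x y → δ i j * x - y)
           (trans (sym (Σ-+ (w i) (λ a → w a i))) (Σ-cong (w-symmetrise i))) (w-symmetrise i j) ⟩
    δ i j * degree G i - adjacency i j
      ≡⟨ laplacian-entry i j ⟨
    laplacian G i j ∎)
    where
    out : Fin n → ℚ
    out a = Σᶠ (w a)
    into = Σᶠ (λ a → w a i)
    inner : ∀ a → Σᶠ (λ b → w a b * ((δ a i - δ b i) * (δ a j - δ b j))) ≡
                  (out a * δ a j) * δ a i + - (w a j) * δ a i + (- (w a i) * δ a j + w a i * δ i j)
    inner a = begin
      Σᶠ (λ b → w a b * ((δ a i - δ b i) * (δ a j - δ b j)))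
        ≡⟨ Σ-cong (λ b → solve 5 (λ w p q r s → w :* ((p :+ :- q) :* (r :+ :- s)) :=
               (w :* (r :* p) :+ (:- p) :* (w :* s)) :+ ((:- r) :* (w :* q) :+ (w :* s) :* q)) refl
             (w a b) (δ a i) (δ b i) (δ a j) (δ b j)) ⟩
      Σᶠ (λ b → (w a b * (δ a j * δ a i) + - δ a i * (w a b * δ b j)) + (- δ a j * (w a b * δ b i) + (w a b * δ b j) * δ b i))
        ≡⟨ trans (Σ-+ (λ b → w a b * (δ a j * δ a i) + - δ a i * (w a b * δ b j)) (λ b → - δ a j * (w a b * δ b i) + (w a b * δ b j) * δ b i))
             (cong₂ _+_ (Σ-+ (λ b → w a b * (δ a j * δ a i)) (λ b → - δ a i * (w a b * δ b j)))
                        (Σ-+ (λ b → - δ a j * (w a b * δ b i)) (λ b → (w a b * δ b j) * δ b i))) ⟩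
      Σᶠ (λ b → w a b * (δ a j * δ a i)) + Σᶠ (λ b → - δ a i * (w a b * δ b j)) +
      (Σᶠ (λ b → - δ a j * (w a b * δ b i)) + Σᶠ (λ b → (w a b * δ b j) * δ b i))
        ≡⟨ cong₂ _+_
             (cong₂ _+_ (Σ-*ʳ (δ a j * δ a i) (w a))
                        (trans (Σ-*ˡ (- δ a i) (λ b → w a b * δ b j)) (cong (- δ a i *_) (Σ-δʳ j (w a)))))
             (cong₂ _+_ (trans (Σ-*ˡ (- δ a j) (λ b → w a b * δ b i)) (cong (- δ a j *_) (Σ-δʳ i (w a))))
                        (Σ-δʳ i (λ b → w a b * δ b j))) ⟩
      out a * (δ a j * δ a i) + - δ a i * w a j + (- δ a j * w a i + w a i * δ i j)
        ≡⟨ solve 6 (λ o p r x y d → o :* (r :* p) :+ (:- p) :* x :+ ((:- r) :* y :+ y :* d) :=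
               (o :* r) :* p :+ (:- x) :* p :+ ((:- y) :* r :+ y :* d)) refl
             (out a) (δ a i) (δ a j) (w a j) (w a i) (δ i j) ⟩
      (out a * δ a j) * δ a i + - (w a j) * δ a i + (- (w a i) * δ a j + w a i * δ i j) ∎

  laplacian-sym : ∀ i j → laplacian G i j ≡ laplacian G j i
  laplacian-sym i j = trans (laplacian-gram i j) (trans (gram-sym incidence (edges G) i j) (sym (laplacian-gram j i)))

  laplacian-const : ∀ i t → Σᶠ (λ j → laplacian G i j * t) ≡ 0ℚ
  laplacian-const i t = begin
    Σᶠ (λ j → laplacian G i j * t)
      ≡⟨ Σ-cong (λ j → cong (_* t) (laplacian-gram i j)) ⟩
    Σᶠ (λ j → gram incidence (edges G) i j * t)
      ≡⟨ gram-apply incidence (λ _ → t) (edges G) i ⟩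
    Σˡ (λ e → incidence e i * Σᶠ (λ j → incidence e j * t)) (edges G)
      ≡⟨ Σˡ-0 (λ e → trans (cong (incidence e i *_) (trans (incidence-apply e (λ _ → t)) (+-inverseʳ t)))
                           (*-zeroʳ (incidence e i))) (edges G) ⟩
    0ℚ ∎

  adj⇒edge : ∀ {i j} → toℕ i ℕ.< toℕ j → T (adj G i j) → (i , j) ∈ edges G
  adj⇒edge {i} {j} i<j t = ∈-filter⁺ (λ e → T? _)
    (∈-concatMap⁺ (λ a → map (a ,_) (allFin n)) (lose (∈-allFin i) (∈-map⁺ (i ,_) (∈-allFin j))))
    (Equivalence.from T-∧ (fromWitness {a? = toℕ i ℕ.<? toℕ j} i<j , t))

  -- A kernel vector pairs to zero with every incidence vector, so it does not change along edges.
  laplacian-kernel : Connected G → (x : Fin n → ℚ) → (∀ i → Σᶠ (λ j → laplacian G i j * x j) ≡ 0ℚ) →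
                     ∀ i j → x i ≡ x j
  laplacian-kernel conn x k = connected-invariant (adj G) (toT conn) x along
    where
    flat : All (λ e → x (proj₁ e) - x (proj₂ e) ≡ 0ℚ) (edges G)
    flat = All.map (λ {e} p → trans (sym (incidence-apply e x)) p)
      (gram-kernel incidence x (edges G)
        (λ i → trans (Σ-cong (λ j → cong (_* x j) (sym (laplacian-gram i j)))) (k i)))
    along-edge : ∀ {i j} → (i , j) ∈ edges G → x i ≡ x j
    along-edge {i} {j} m = begin
      x i              ≡⟨ solve 2 (λ a b → a := (a :+ :- b) :+ b) refl (x i) (x j) ⟩
      x i - x j + x j  ≡⟨ cong (_+ x j) (All.lookup flat m) ⟩
      0ℚ + x j         ≡⟨ +-identityˡ (x j) ⟩
      x j              ∎
    along : ∀ i j → T (adj G i j) → x i ≡ x j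
    along i j t with ℕ.<-cmp (toℕ i) (toℕ j)
    ... | tri< i<j _ _ = along-edge (adj⇒edge i<j t)
    ... | tri≈ _ i≡j _ = cong x (toℕ-injective i≡j)
    ... | tri> _ _ j<i = sym (along-edge (adj⇒edge j<i (subst T (adj-sym G i j) t)))

-- The pseudoinverse and the biharmonic distance

⊗-cong : ∀ {n} {A A' B B' : Mat n} → A ≈ A' → B ≈ B' → A ⊗ B ≈ A' ⊗ B'
⊗-cong e f i j = Σ-cong (λ k → cong₂ _*_ (e i k) (f k j))

⊗-congˡ : ∀ {n} (A : Mat n) {B B'} → B ≈ B' → A ⊗ B ≈ A ⊗ B'
⊗-congˡ A {B} {B'} = ⊗-cong {A = A} {A} {B} {B'} (λ _ _ → refl)

⊗-congʳ : ∀ {n} {A A'} (B : Mat n) → A ≈ A' → A ⊗ B ≈ A' ⊗ B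
⊗-congʳ {A = A} {A'} B e = ⊗-cong {A = A} {A'} {B} {B} e (λ _ _ → refl)

⊗-assoc : ∀ {n} (A B C : Mat n) → (A ⊗ B) ⊗ C ≈ A ⊗ (B ⊗ C)
⊗-assoc A B C i j = begin
  Σᶠ (λ k → Σᶠ (λ l → A i l * B l k) * C k j)
    ≡⟨ Σ-cong (λ k → Σ-*ʳ (C k j) (λ l → A i l * B l k)) ⟨
  Σᶠ (λ k → Σᶠ (λ l → A i l * B l k * C k j))
    ≡⟨ Σ-swap (λ k l → A i l * B l k * C k j) ⟩
  Σᶠ (λ l → Σᶠ (λ k → A i l * B l k * C k j))
    ≡⟨ Σ-cong (λ l → trans (Σ-cong (λ k → *-assoc (A i l) (B l k) (C k j))) (Σ-*ˡ (A i l) (λ k → B l k * C k j))) ⟩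
  Σᶠ (λ l → A i l * Σᶠ (λ k → B l k * C k j)) ∎

⊗-transpose : ∀ {n} (A B : Mat n) → transpose (A ⊗ B) ≈ transpose B ⊗ transpose A
⊗-transpose A B i j = Σ-cong (λ k → *-comm (A j k) (B k i))

⊗-δ : ∀ {n} (A : Mat n) → A ⊗ δ ≈ A
⊗-δ A i j = Σ-δʳ j (A i)

Mat-setoid : ℕ → Setoid 0ℓ 0ℓ
Mat-setoid n = record
  { Carrier = Mat n
  ; _≈_ = _≈_
  ; isEquivalence = record
    { refl  = λ _ _ → refl
    ; sym   = λ e i j → sym (e i j)
    ; trans = λ e f i j → trans (e i j) (f i j)
    }
  }

module SymmetricInverse {n} (L X : Mat n) (L-sym : transpose L ≈ L) (mp : IsMoorePenroseInverse L X) where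

  open Setoid (Mat-setoid n) using () renaming (refl to ≈-refl; sym to ≈-sym; trans to ≈-trans)
  open SetoidReasoning (Mat-setoid n) renaming (begin_ to begin≈_; _∎ to _∎≈)

  Y : Mat n
  Y = transpose X

  LXL : (L ⊗ X) ⊗ L ≈ L
  LXL = proj₁ mp
  XLX : (X ⊗ L) ⊗ X ≈ X
  XLX = proj₁ (proj₂ mp)
  LX-sym : transpose (L ⊗ X) ≈ L ⊗ X
  LX-sym = proj₁ (proj₂ (proj₂ mp))
  XL-sym : transpose (X ⊗ L) ≈ X ⊗ L
  XL-sym = proj₂ (proj₂ (proj₂ mp))

  LX≈YL : L ⊗ X ≈ Y ⊗ L
  LX≈YL = ≈-trans (≈-sym LX-sym) (≈-trans (⊗-transpose L X) (⊗-congˡ Y L-sym))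

  XL≈LY : X ⊗ L ≈ L ⊗ Y
  XL≈LY = ≈-trans (≈-sym XL-sym) (≈-trans (⊗-transpose X L) (⊗-congʳ Y L-sym))

  -- Symmetry of `L` turns the two symmetry equations into `L X = Y L` and `X L = L Y`. Inserting
  -- `L = L X L` on each right side shows that both projections equal their product.
  LX≈XL : L ⊗ X ≈ X ⊗ L
  LX≈XL = ≈-trans LX≈product (≈-sym XL≈product)
    where
    LX≈product : L ⊗ X ≈ (L ⊗ X) ⊗ (X ⊗ L)
    LX≈product = begin≈
      L ⊗ X                                        ≈⟨ LX≈YL ⟩
      Y ⊗ L                                        ≈⟨ ⊗-congˡ Y LXL ⟨
      Y ⊗ ((L ⊗ X) ⊗ L)                            ≈⟨ ⊗-congˡ Y (⊗-assoc L X L) ⟩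
      Y ⊗ (L ⊗ (X ⊗ L))                            ≈⟨ ⊗-assoc Y L (X ⊗ L) ⟨
      (Y ⊗ L) ⊗ (X ⊗ L)                            ≈⟨ ⊗-congʳ (X ⊗ L) LX≈YL ⟨
      (L ⊗ X) ⊗ (X ⊗ L)                            ∎≈
    XL≈product : X ⊗ L ≈ (L ⊗ X) ⊗ (X ⊗ L)
    XL≈product = begin≈
      X ⊗ L                                        ≈⟨ XL≈LY ⟩
      L ⊗ Y                                        ≈⟨ ⊗-congʳ Y LXL ⟨
      ((L ⊗ X) ⊗ L) ⊗ Y                            ≈⟨ ⊗-assoc (L ⊗ X) L Y ⟩
      (L ⊗ X) ⊗ (L ⊗ Y)                            ≈⟨ ⊗-congˡ (L ⊗ X) XL≈LY ⟨
      (L ⊗ X) ⊗ (X ⊗ L)                            ∎≈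

  -- Both sides equal `Y L Y`: from `X L X` by the exchange rules above, and as the transpose of
  -- `X L X`.
  Y≈X : Y ≈ X
  Y≈X = ≈-sym (begin≈
    X                                              ≈⟨ XLX ⟨
    (X ⊗ L) ⊗ X                                    ≈⟨ ⊗-assoc X L X ⟩
    X ⊗ (L ⊗ X)                                    ≈⟨ ⊗-congˡ X (≈-trans LX≈XL XL≈LY) ⟩
    X ⊗ (L ⊗ Y)                                    ≈⟨ ⊗-assoc X L Y ⟨
    (X ⊗ L) ⊗ Y                                    ≈⟨ ⊗-congʳ Y LX≈XL ⟨
    (L ⊗ X) ⊗ Y                                    ≈⟨ ⊗-congʳ Y LX≈YL ⟩
    (Y ⊗ L) ⊗ Y                                    ≈⟨ ⊗-assoc Y L Y ⟩
    Y ⊗ (L ⊗ Y)                                    ≈⟨ ⊗-congˡ Y XL≈LY ⟨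
    Y ⊗ (X ⊗ L)                                    ≈⟨ ⊗-congˡ Y XL-sym ⟨
    Y ⊗ transpose (X ⊗ L)                          ≈⟨ ⊗-transpose (X ⊗ L) X ⟨
    transpose ((X ⊗ L) ⊗ X)                        ≈⟨ (λ i j → XLX j i) ⟩
    Y                                              ∎≈)

  XX-sym : transpose (X ⊗ X) ≈ X ⊗ X
  XX-sym = ≈-trans (⊗-transpose X X) (⊗-cong Y≈X Y≈X)

  LX-idem : L ⊗ (L ⊗ X) ≈ L
  LX-idem = begin≈
    L ⊗ (L ⊗ X)   ≈⟨ ⊗-congˡ L LX≈XL ⟩
    L ⊗ (X ⊗ L)   ≈⟨ ⊗-assoc L X L ⟨
    (L ⊗ X) ⊗ L   ≈⟨ LXL ⟩
    L             ∎≈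

  LLXX≈LX : (L ⊗ L) ⊗ (X ⊗ X) ≈ L ⊗ X
  LLXX≈LX = begin≈
    (L ⊗ L) ⊗ (X ⊗ X)     ≈⟨ ⊗-assoc L L (X ⊗ X) ⟩
    L ⊗ (L ⊗ (X ⊗ X))     ≈⟨ ⊗-congˡ L (⊗-assoc L X X) ⟨
    L ⊗ ((L ⊗ X) ⊗ X)     ≈⟨ ⊗-congˡ L (⊗-congʳ X LX≈XL) ⟩
    L ⊗ ((X ⊗ L) ⊗ X)     ≈⟨ ⊗-congˡ L XLX ⟩
    L ⊗ X                 ∎≈

-- The summand keeps the shape that the rank-one determinant formula gives for `I + J`.
Σ-ones : ∀ n → Σᶠ {n} (λ _ → 1ℚ * 1ℚ) ≡ fromℕ n
Σ-ones zero    = refl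
Σ-ones (suc n) = trans (cong (1ℚ +_) (Σ-ones n)) (sym (fromℕ-suc n))

delete : ∀ {n} → Fin (suc n) → Mat (suc n) → Mat n
delete u A i j = A (punchIn u i) (punchIn u j)

-- Rows and columns of L sum to zero, so the deleted vertex contributes r i * c j, where r and c are
-- the row and column sums of the reduced matrix.
delete-square : ∀ {n} (L : Mat (suc n)) u → (∀ i → Σᶠ (L i) ≡ 0ℚ) → (∀ j → Σᶠ (λ i → L i j) ≡ 0ℚ) →
                delete u (L ⊗ L) ≈ (delete u L ⊗ (δ +ᵣ (λ _ → 1ℚ) ⊠ (λ _ → 1ℚ))) ⊗ delete u L
delete-square {n} L u rows cols i j = begin
  Σᶠ (λ k → L (p i) k * L k (p j))
    ≡⟨ Σ-remove u (λ k → L (p i) k * L k (p j)) ⟩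
  L (p i) u * L u (p j) + Σᶠ (λ k → A i k * A k j)
    ≡⟨ cong₂ (λ x y → x * y + Σᶠ (λ k → A i k * A k j))
         (opposite {L (p i) u} (trans (sym (Σ-remove u (L (p i)))) (rows (p i))))
         (opposite {L u (p j)} (trans (sym (Σ-remove u (λ k → L k (p j)))) (cols (p j)))) ⟩
  - r * - c + Σᶠ (λ k → A i k * A k j)
    ≡⟨ solve 3 (λ r c s → :- r :* :- c :+ s := s :+ r :* c) refl r c (Σᶠ (λ k → A i k * A k j)) ⟩
  Σᶠ (λ k → A i k * A k j) + r * c
    ≡⟨ cong (Σᶠ (λ k → A i k * A k j) +_) (Σ-*ˡ r (λ k → A k j)) ⟨
  Σᶠ (λ k → A i k * A k j) + Σᶠ (λ k → r * A k j)
    ≡⟨ Σ-+ (λ k → A i k * A k j) (λ k → r * A k j) ⟨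
  Σᶠ (λ k → A i k * A k j + r * A k j)
    ≡⟨ Σ-cong (λ k → trans (sym (*-distribʳ-+ (A k j) (A i k) r)) (cong (_* A k j) (row k))) ⟩
  Σᶠ (λ k → (A ⊗ (δ +ᵣ (λ _ → 1ℚ) ⊠ (λ _ → 1ℚ))) i k * A k j) ∎
  where
  p = punchIn u
  A = delete u L
  r = Σᶠ (A i)
  c = Σᶠ (λ k → A k j)
  opposite : ∀ {x y} → x + y ≡ 0ℚ → x ≡ - y
  opposite {x} {y} e = trans (solve 2 (λ x y → x := (x :+ y) :+ :- y) refl x y)
                             (trans (cong (_+ - y) e) (+-identityˡ (- y)))
  row : ∀ k → A i k + r ≡ (A ⊗ (δ +ᵣ (λ _ → 1ℚ) ⊠ (λ _ → 1ℚ))) i k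
  row k = sym (trans (⊗-δ+rank-one (λ _ → 1ℚ) (λ _ → 1ℚ) A i k)
    (cong (A i k +_) (trans (*-identityʳ _) (Σ-cong (λ l → *-identityʳ (A i l))))))

-- Solving the reduced system for the squared Laplacian

module _ {m} (G : Graph (suc (suc m))) (conn : Connected G)
         (X : Mat (suc (suc m))) (mp : IsMoorePenroseInverse (laplacian G) X) where

  private
    L : Mat (suc (suc m))
    L = laplacian G
    M : Mat (suc (suc m))
    M = L ⊗ L

  open SymmetricInverse L X (λ i j → laplacian-sym G j i) mp

  M-sym : ∀ i j → M i j ≡ M j i
  M-sym i j = trans (⊗-transpose L L j i) (⊗-cong (λ i j → laplacian-sym G j i) (λ i j → laplacian-sym G j i) j i)

  M-const : ∀ i t → Σᶠ (λ j → M i j * t) ≡ 0ℚ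
  M-const i t = begin
    -- The constant vector is taken as a column of the constant matrix so that associativity
    -- applies; the final index `i` merely picks one of its equal columns.
    Σᶠ (λ j → M i j * t)                      ≡⟨ ⊗-assoc L L (λ _ _ → t) i i ⟩
    Σᶠ (λ j → L i j * Σᶠ (λ k → L j k * t))   ≡⟨ Σ-0 (λ j → trans (cong (L i j *_) (laplacian-const G j t)) (*-zeroʳ (L i j))) ⟩
    0ℚ                                        ∎

  row-sums : ∀ i → Σᶠ (L i) ≡ 0ℚ
  row-sums i = trans (Σ-cong (λ j → sym (*-identityʳ (L i j)))) (laplacian-const G i 1ℚ)

  -- δ - L X is a constant multiple of the all-ones matrix.
  projection-columns : ∀ i u v → (L ⊗ X) i v - (L ⊗ X) i u ≡ δ i v - δ i u
  projection-columns i u v = begin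
    H i v - H i u
      ≡⟨ solve 4 (λ a b c d → b :+ :- a := (:- (d :+ :- b) :+ (c :+ :- a)) :+ (d :+ :- c)) refl
           (H i u) (H i v) (δ i u) (δ i v) ⟩
    (- Q i v + Q i u) + (δ i v - δ i u)
      -- `Q` is symmetric and constant down each column, hence constant along rows too.
      ≡⟨ cong (λ x → (- x + Q i u) + (δ i v - δ i u)) (trans (Q-sym i v) (trans (columns i v u) (Q-sym u i))) ⟩
    (- Q i u + Q i u) + (δ i v - δ i u)
      ≡⟨ solve 2 (λ q d → (:- q :+ q) :+ d := d) refl (Q i u) (δ i v - δ i u) ⟩
    δ i v - δ i u ∎
    where
    H = L ⊗ X
    Q : Mat (suc (suc m))
    Q i j = δ i j - H i j
    Q-sym : ∀ i j → Q i j ≡ Q j i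
    Q-sym i j = cong₂ _-_ (δ-sym i j) (LX-sym j i)
    columns : ∀ j i k → Q i j ≡ Q k j
    -- `L Q = L - L (L X) = 0`, so every column of `Q` lies in the kernel of the Laplacian.
    columns j = laplacian-kernel G conn (λ i → Q i j) (λ i → begin
      Σᶠ (λ k → L i k * (δ k j - H k j))
        ≡⟨ Σ-cong (λ k → solve 3 (λ l d h → l :* (d :+ :- h) := l :* d :+ :- (l :* h)) refl (L i k) (δ k j) (H k j)) ⟩
      Σᶠ (λ k → L i k * δ k j + - (L i k * H k j))
        ≡⟨ Σ-+ (λ k → L i k * δ k j) (λ k → - (L i k * H k j)) ⟩
      (L ⊗ δ) i j + Σᶠ (λ k → - (L i k * H k j))
        ≡⟨ cong₂ _+_ (⊗-δ L i j) (trans (Σ-neg (λ k → L i k * H k j)) (cong -_ (LX-idem i j))) ⟩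
      L i j - L i j
        ≡⟨ +-inverseʳ (L i j) ⟩
      0ℚ ∎)

  det-reduced-square : ∀ u → det (delete u M) ≡ fromℕ (suc (suc m)) * (fromℕ (τ G) * fromℕ (τ G))
  det-reduced-square u = begin
    det (delete u M)
      ≡⟨ det-resp (delete-square L u row-sums (λ j → trans (Σ-cong (λ i → laplacian-sym G i j)) (row-sums j))) ⟩
    det ((A ⊗ I+J) ⊗ A)
      ≡⟨ trans (det-⊗ (A ⊗ I+J) A) (cong (_* det A) (det-⊗ A I+J)) ⟩
    (det A * det I+J) * det A
      ≡⟨ cong₂ (λ x y → (x * y) * x) detA detI+J ⟩
    (fromℕ (τ G) * fromℕ (suc (suc m))) * fromℕ (τ G)
      ≡⟨ solve 2 (λ t n → (t :* n) :* t := n :* (t :* t)) refl (fromℕ (τ G)) (fromℕ (suc (suc m))) ⟩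
    fromℕ (suc (suc m)) * (fromℕ (τ G) * fromℕ (τ G)) ∎
    where
    A = delete u L
    I+J : Mat (suc m)
    I+J = δ +ᵣ (λ _ → 1ℚ) ⊠ (λ _ → 1ℚ)
    -- The reduced matrix has order n - 1, so its determinant is 1 + (n - 1) = n.
    detI+J : det I+J ≡ fromℕ (suc (suc m))
    detI+J = trans (det-δ+rank-one {suc m} (λ _ → 1ℚ) (λ _ → 1ℚ)) (trans (cong (1ℚ +_) (Σ-ones (suc m))) (sym (fromℕ-suc (suc m))))
    detA : det A ≡ fromℕ (τ G)
    detA = trans (det-resp (λ i j → trans (laplacian-gram G (punchIn u i) (punchIn u j))
                    (sym (gram-cong {v = grounded u} {w = incidence} (punchIn u) (λ _ _ → refl) (edges G) i j))))
                 (matrix-tree (suc m) (edges G) u)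

  module _ (u v : Fin (suc (suc m))) (u≢v : u ≢ v) where

    private
      z : Fin (suc (suc m)) → ℚ
      z i = ((X ⊗ X) i v - (X ⊗ X) i u) - ((X ⊗ X) u v - (X ⊗ X) u u)
      v' = punchOut u≢v

    z-solves : ∀ i → Σᶠ (λ k → M i k * z k) ≡ δ i v - δ i u
    z-solves i = begin
      Σᶠ (λ k → M i k * z k)
        ≡⟨ Σ-cong (λ k → solve 4 (λ m a b c → m :* ((a :+ :- b) :+ :- c) := (m :* a :+ :- (m :* b)) :+ m :* :- c) refl
             (M i k) ((X ⊗ X) k v) ((X ⊗ X) k u) t) ⟩
      Σᶠ (λ k → (M i k * (X ⊗ X) k v + - (M i k * (X ⊗ X) k u)) + M i k * - t)
        ≡⟨ trans (Σ-+ (λ k → M i k * (X ⊗ X) k v + - (M i k * (X ⊗ X) k u)) (λ k → M i k * - t))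
             (cong₂ _+_ (trans (Σ-+ (λ k → M i k * (X ⊗ X) k v) (λ k → - (M i k * (X ⊗ X) k u)))
                               (cong ((M ⊗ (X ⊗ X)) i v +_) (Σ-neg (λ k → M i k * (X ⊗ X) k u))))
                        (M-const i (- t))) ⟩
      ((M ⊗ (X ⊗ X)) i v - (M ⊗ (X ⊗ X)) i u) + 0ℚ
        ≡⟨ trans (+-identityʳ _) (cong₂ _-_ (LLXX≈LX i v) (LLXX≈LX i u)) ⟩
      (L ⊗ X) i v - (L ⊗ X) i u
        ≡⟨ projection-columns i u v ⟩
      δ i v - δ i u ∎
      where t = (X ⊗ X) u v - (X ⊗ X) u u

    -- As `z u` is 0, the deleted column contributes nothing. Symmetry of `M` moves `z` to the left,
    -- where the row form of Cramer's rule takes it.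
    z-reduced : ∀ j → Σᶠ (λ k → z (punchIn u k) * delete u M k j) ≡ δ v' j
    z-reduced j = begin
      Σᶠ (λ k → z (punchIn u k) * M (punchIn u k) (punchIn u j))
        ≡⟨ Σ-cong (λ k → trans (cong (z (punchIn u k) *_) (M-sym (punchIn u k) (punchIn u j))) (*-comm (z (punchIn u k)) (M (punchIn u j) (punchIn u k)))) ⟩
      Σᶠ (λ k → M (punchIn u j) (punchIn u k) * z (punchIn u k))
        ≡⟨ solve 1 (λ s → s := con 0ℚ :+ s) refl _ ⟩
      0ℚ + Σᶠ (λ k → M (punchIn u j) (punchIn u k) * z (punchIn u k))
        ≡⟨ cong (_+ Σᶠ (λ k → M (punchIn u j) (punchIn u k) * z (punchIn u k)))
             (trans (cong (M (punchIn u j) u *_) (+-inverseʳ ((X ⊗ X) u v - (X ⊗ X) u u))) (*-zeroʳ (M (punchIn u j) u))) ⟨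
      M (punchIn u j) u * z u + Σᶠ (λ k → M (punchIn u j) (punchIn u k) * z (punchIn u k))
        ≡⟨ Σ-remove u (λ k → M (punchIn u j) k * z k) ⟨
      Σᶠ (λ k → M (punchIn u j) k * z k)
        ≡⟨ z-solves (punchIn u j) ⟩
      δ (punchIn u j) v - δ (punchIn u j) u
        ≡⟨ cong₂ _-_ (cong (δ (punchIn u j)) (punchIn-punchOut u≢v)) (sym (δ-≢ (punchInᵢ≢i u j))) ⟨
      δ (punchIn u j) (punchIn u v') - 0ℚ
        ≡⟨ trans (+-identityʳ _) (trans (δ-inj (punchIn u) (punchIn-injective u _ _) j v') (δ-sym j v')) ⟩
      δ v' j ∎

    -- `dB²` uses the entry at (u , v) twice, so symmetry of the squared pseudoinverse is what
    -- identifies the two.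
    z-at-v : z (punchIn u v') ≡ dB² X u v
    z-at-v = begin
      z (punchIn u v')
        ≡⟨ cong z (punchIn-punchOut u≢v) ⟩
      ((X ⊗ X) v v - (X ⊗ X) v u) - ((X ⊗ X) u v - (X ⊗ X) u u)
        ≡⟨ cong (λ x → ((X ⊗ X) v v - x) - ((X ⊗ X) u v - (X ⊗ X) u u)) (XX-sym u v) ⟩
      ((X ⊗ X) v v - (X ⊗ X) u v) - ((X ⊗ X) u v - (X ⊗ X) u u)
        ≡⟨ solve 3 (λ a b c → (a :+ :- b) :+ :- (b :+ :- c) := (c :+ a) :+ :- (b :+ b)) refl
             ((X ⊗ X) v v) ((X ⊗ X) u v) ((X ⊗ X) u u) ⟩
      dB² X u v ∎

    biharmonic-determinant : dB² X u v * (fromℕ (suc (suc m)) * (fromℕ (τ G) * fromℕ (τ G))) ≡ det (minor₂ u v u≢v M)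
    biharmonic-determinant = begin
      dB² X u v * (fromℕ (suc (suc m)) * (fromℕ (τ G) * fromℕ (τ G)))
        ≡⟨ cong₂ _*_ z-at-v (det-reduced-square u) ⟨
      z (punchIn u v') * det A
        ≡⟨ cramer A v' (z ∘ punchIn u) ⟨
      det (A [ v' ≔ (λ j → Σᶠ (λ k → z (punchIn u k) * A k j)) ])
        ≡⟨ det-resp replace ⟩
      det (A [ v' ≔ δ v' ])
        -- `minor₂` also removes `u` first and then `v` at its index among the remaining vertices,
        -- so the two matrices agree by definition.
        ≡⟨ det-unit-row A v' ⟩
      det (minor₂ u v u≢v M) ∎
      where
      A = delete u M
      replace : A [ v' ≔ (λ j → Σᶠ (λ k → z (punchIn u k) * A k j)) ] ≈ A [ v' ≔ δ v' ]
      replace k j with k ≟ᶠ v'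
      ... | yes refl = trans (≔-same A v' (λ j → Σᶠ (λ k → z (punchIn u k) * A k j)) j) (trans (z-reduced j) (sym (≔-same A v' (δ v') j)))
      ... | no  ne   = ≔-≔-off A v' (λ j → Σᶠ (λ k → z (punchIn u k) * A k j)) (δ v') k ne j

theorem3p5 : (n : ℕ) (G : Graph n) → Connected G →
    (Lp : Mat n) → IsMoorePenroseInverse (laplacian G) Lp →
    (u v : Fin n) (u≢v : u ≢ v) →
    dB² Lp u v * (fromℕ n * (fromℕ (τ G) * fromℕ (τ G)))
    ≡ det (minor₂ u v u≢v (laplacian G ⊗ laplacian G))
theorem3p5 (suc zero)    G conn Lp mp zero zero u≢v = contradiction refl u≢v
theorem3p5 (suc (suc m)) G conn Lp mp u v u≢v = biharmonic-determinant G conn Lp mp u v u≢v
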